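{- For every $b\ge 0$ and every $0<\gamma<\frac18$ there exist a positive integer $n_{b,\gamma}$ and $0<\delta<1$ such that if $n>n_{b,\gamma}$ and $\mathcal D$ is a degree sequence of length $n$ with $M_{\mathcal D}\le b$, then the probability that $G(\mathcal D)$ has a component of order at least $\gamma n$ lies between $\delta$ and $1-\delta$.
   Context: A degree sequence $\mathcal D=(d_1,\dots,d_n)$ consists of positive integers (no zero entries); $G(\mathcal D)$ denotes a uniformly random simple graph on $\{1,\dots,n\}$ in which vertex $i$ has degree $d_i$ (the sequence is assumed to be realizable by some simple graph). $M_{\mathcal D}=\sum_{i:d_i\ne 2}d_i$. The order of a component is its number of vertices.
   Formalization: The formal theorem takes γ to be a rational number in (0, 1/8) and b a natural number; real γ follows by placing it between two rationals, as the event is monotone in γ, and real b by rounding down. -}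

module Defs where

open import Data.Bool using (Bool; true; false; _∧_; _∨_; not; if_then_else_)
open import Data.Nat using (ℕ; zero; suc; _+_; _≡ᵇ_; _≤ᵇ_)
open import Data.Fin using (Fin)
open import Data.List using (List; []; _∷_; concatMap; map; length; filterᵇ)
open import Data.Vec using (Vec; []; _∷_; lookup; tabulate; allFin; foldr)
open import Data.Integer using (+_)
open import Data.Rational using (ℚ; _/_; _*_)
import Data.Rational
open import Relation.Nullary.Decidable using (⌊_⌋)

ℕ→ℚ : ℕ → ℚ
ℕ→ℚ n = + n / 1

allVecsOf : {A : Set} → List A → (m : ℕ) → List (Vec A m)
allVecsOf xs zero    = [] ∷ []
allVecsOf xs (suc m) = concatMap (λ x → map (x ∷_) (allVecsOf xs m)) xs

anyFin : {n : ℕ} → (Fin n → Bool) → Bool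
anyFin {n} p = foldr _ (λ i b → p i ∨ b) false (allFin n)

allFin? : {n : ℕ} → (Fin n → Bool) → Bool
allFin? {n} p = foldr _ (λ i b → p i ∧ b) true (allFin n)

countFin : {n : ℕ} → (Fin n → Bool) → ℕ
countFin {n} p = foldr _ (λ i k → (if p i then 1 else 0) + k) 0 (allFin n)

Adj : ℕ → Set
Adj n = Vec (Vec Bool n) n

adj : {n : ℕ} → Adj n → Fin n → Fin n → Bool
adj A i j = lookup (lookup A i) j

-- all n×n boolean matrices (finite enumeration, each exactly once)
allAdj : (n : ℕ) → List (Adj n)
allAdj n = allVecsOf (allVecsOf (true ∷ false ∷ []) n) n

_==_ : Bool → Bool → Bool
true  == b = b
false == b = not b

isSimple : {n : ℕ} → Adj n → Bool
isSimple A = allFin? (λ i → not (adj A i i) ∧ allFin? (λ j → adj A i j == adj A j i))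

degree : {n : ℕ} → Adj n → Fin n → ℕ
degree A i = countFin (adj A i)

hasDegrees : {n : ℕ} → Adj n → Vec ℕ n → Bool
hasDegrees A d = allFin? (λ i → degree A i ≡ᵇ lookup d i)

-- the simple graphs on {1..n} with degree sequence d (the sample space of G(D))
graphsWithDegrees : (n : ℕ) → Vec ℕ n → List (Adj n)
graphsWithDegrees n d = filterᵇ (λ A → isSimple A ∧ hasDegrees A d) (allAdj n)

Realizable : {n : ℕ} → Vec ℕ n → Set
Realizable {n} d = 1 Data.Nat.≤ length (graphsWithDegrees n d)

Positive : {n : ℕ} → Vec ℕ n → Set
Positive d = ∀ i → 1 Data.Nat.≤ lookup d i

M : {n : ℕ} → Vec ℕ n → ℕ
M d = foldr _ (λ x s → (if x ≡ᵇ 2 then 0 else x) + s) 0 d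

step : {n : ℕ} → Adj n → (Fin n → Bool) → (Fin n → Bool)
step A S j = S j ∨ anyFin (λ i → S i ∧ adj A i j)

reachWithin : {n : ℕ} → Adj n → ℕ → Fin n → (Fin n → Bool)
reachWithin A zero    v j = ⌊ v Data.Fin.≟ j ⌋
reachWithin A (suc k) v = step A (reachWithin A k v)

-- the component containing v (every vertex of it is reached by a walk of length ≤ n)
component : {n : ℕ} → Adj n → Fin n → (Fin n → Bool)
component {n} A v = reachWithin A n v

componentOrder : {n : ℕ} → Adj n → Fin n → ℕ
componentOrder A v = countFin (component A v)

hasComponentOfOrder≥ : {n : ℕ} → ℚ → Adj n → Bool
hasComponentOfOrder≥ {n} γ A = anyFin (λ v → Data.Rational._≤ᵇ_ (γ * ℕ→ℚ n) (ℕ→ℚ (componentOrder A v)))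

goodCount : (n : ℕ) → Vec ℕ n → ℚ → ℕ
goodCount n d γ = length (filterᵇ (hasComponentOfOrder≥ γ) (graphsWithDegrees n d))

totalCount : (n : ℕ) → Vec ℕ n → ℕ
totalCount n d = length (graphsWithDegrees n d)

{-# OPTIONS --safe #-}
-- Both bounds are proved by double counting 2-switches (delete the edges pq and rs, insert pr and qs).
-- Since M ≤ b, the vertices within distance K of a vertex of degree ≠ 2 number at most b (K + 1); hence
-- any set of more vertices contains the start of a walk of length K through vertices of degree 2 only.
-- Cutting a segment out of such a walk and closing it up to a cycle is a switch. When K is linear in n
-- there are of order n² such switches, of at most (2n + b)² switches in all, so passing to a graph that
-- is reached by them costs a constant factor.
-- No large component: each cut removes linearly many vertices from the components of order at least γ n,
-- so boundedly many cuts destroy all of them.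
-- Large component: fix a vertex v and suppose that all components have order below γ n < n/8. If the
-- all-degree-2 components avoiding v contain at least n/2 vertices, there are deg v · n switches that
-- merge one of them into the component of v, while at most 3/4 deg v · n reversed switches lead back,
-- because the merged component has order at most n/4. So at most 3/4 of all graphs are of this kind.
-- In the remaining ones linearly many vertices lie in components with a vertex of degree ≠ 2; cutting
-- a segment out of one such component and merging it into another increases the latter linearly.
module Submission where

open import Defs

-- Chains of lossy steps prove something only if they start from a positive share of all graphs.
-- When large components are destroyed, the start is all graphs. When one is built, the graph may
-- consist mostly of short cycles; merging one of them gains no linear number of vertices, so
-- boundedly many such steps would not suffice. That case is therefore excluded by a single
-- comparison whose ratio must lie strictly below 1. A component with s vertices has at most 2 s + M
-- darts (oriented edges), and s ≤ n/4 together with M ≤ n/4 gives 3 n/4. The bound 1/8 also leaves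
-- at least n - n/2 - n/8 = 3 n/8 vertices for the components with a vertex of degree ≠ 2, and n/4
-- of these outside any given component. A merge absorbs only cycles: a cycle stays connected when
-- one of its edges is deleted, so a merge disconnects nothing. A cut followed by a merge consists
-- of two switches, and the graph in between need not satisfy the conditions of either level; its
-- class is defined by the number of switches that lead on.

module Switching where

  open import Data.Bool using (Bool; true; false; _∧_; _∨_; _xor_; not; if_then_else_; T)
  open import Data.Bool.Properties using (T-∧; T-∨; T?)
  open import Data.Empty using (⊥; ⊥-elim)
  open import Data.Fin using (Fin; zero; suc; toℕ; fromℕ<)
  open import Data.Fin.Properties using (pigeonhole; any?; toℕ-injective; toℕ<n) renaming (_≟_ to _≟F_)
  open import Data.List using (List; []; _∷_; _++_; map; length; filterᵇ; concatMap; cartesianProduct; cartesianProductWith; allFin; applyUpTo)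
  open import Data.List.Properties using (length-++; length-map; length-tabulate; length-applyUpTo; filter-++)
  open import Data.List.Membership.Propositional using (_∈_; _∉_)
  open import Data.List.Membership.Propositional.Properties using (∈-filter⁺; ∈-filter⁻; ∈-map⁺; ∈-map⁻; ∈-++⁺ˡ; ∈-++⁺ʳ; ∈-++⁻; ∈-∃++; ∈-cartesianProduct⁺; ∈-allFin; ∈-applyUpTo⁺; ∈-cartesianProductWith⁺)
  open import Data.List.Relation.Unary.Any using (here; there)
  open import Data.List.Relation.Unary.All using ([]; _∷_)
  import Data.List.Relation.Unary.All as All
  open import Data.List.Relation.Unary.AllPairs using ([]; _∷_)
  open import Data.List.Relation.Unary.Unique.Propositional using (Unique)
  import Data.List.Relation.Unary.Unique.Propositional.Properties as Uniq
  open import Data.Nat using (ℕ; zero; suc; _+_; _*_; _∸_; _^_; _≤_; _<_; _≤ᵇ_; _≡ᵇ_; z≤n; s≤s; s≤s⁻¹; NonZero; >-nonZero; _≤?_)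
  open import Data.Nat.Properties hiding (_≟_)
  open import Data.Product using (Σ; ∃; _×_; _,_; proj₁; proj₂; uncurry)
  open import Data.Sum using (_⊎_; inj₁; inj₂; [_,_]′)
  open import Data.Unit using (tt)
  open import Data.Vec using (Vec; []; _∷_; lookup)
  import Data.Vec as Vec
  import Data.Vec.Properties as VecP
  open import Function using (_∘_; id; case_of_)
  open import Function.Bundles using (Equivalence)
  open import Relation.Binary.PropositionalEquality using (_≡_; _≢_; refl; sym; trans; cong; cong₂; subst; subst₂)
  open import Relation.Nullary using (¬_; Dec; yes; no)
  open import Relation.Binary.Definitions using (tri<; tri≈; tri>)
  open import Relation.Nullary.Decidable using (⌊_⌋; toWitness; fromWitness; _×-dec_; ¬?)
  open import Data.Nat.ListAction using (sum)
  open import Data.Nat.Tactic.RingSolver using (solve-∀)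
  open import Data.List.Properties using (map-tabulate)
  import Data.List.Membership.DecPropositional as DecMembership
  open import Data.Nat.DivMod using (m/n*n≤m; m%n<n; m≡m%n+[m/n]*n; m≥n⇒m/n>0) renaming (_/_ to _div_; _%_ to _mod_)
  open import Data.Nat.Coprimality using (Coprime; 1-coprimeTo) renaming (sym to coprime-sym)
  import Data.Integer as ℤ
  import Data.Integer.Properties as ℤP
  import Data.Rational as ℚ
  import Data.Rational.Properties as ℚP
  import Data.Rational.Unnormalised as ℚᵘ
  import Data.Rational.Unnormalised.Properties as ℚᵘP

  -- Boolean reflection, counting and sums over lists.

  T-split : ∀ {x y} → T (x ∧ y) → T x × T y
  T-split = Equivalence.to T-∧

  T-pair : ∀ {x y} → T x → T y → T (x ∧ y)
  T-pair a b = Equivalence.from T-∧ (a , b)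

  T-cases : ∀ {x y} → T (x ∨ y) → T x ⊎ T y
  T-cases = Equivalence.to T-∨

  T-inl : ∀ {x y} → T x → T (x ∨ y)
  T-inl = Equivalence.from T-∨ ∘ inj₁

  T-inr : ∀ {x y} → T y → T (x ∨ y)
  T-inr {x} = Equivalence.from (T-∨ {x}) ∘ inj₂

  T-not : ∀ {x} → ¬ T x → T (not x)
  T-not {false} _ = tt
  T-not {true} h = ⊥-elim (h tt)

  not-T : ∀ {x} → T (not x) → ¬ T x
  not-T {false} _ ()

  bit : Bool → ℕ
  bit b = if b then 1 else 0

  count : {A : Set} → (A → Bool) → List A → ℕ
  count p xs = length (filterᵇ p xs)

  module _ {A : Set} where

    ∈-filterᵇ⁺ : (p : A → Bool) {x : A} {xs : List A} → x ∈ xs → T (p x) → x ∈ filterᵇ p xs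
    ∈-filterᵇ⁺ p = ∈-filter⁺ (T? ∘ p)

    ∈-filterᵇ⁻ : (p : A → Bool) {x : A} {xs : List A} → x ∈ filterᵇ p xs → x ∈ xs × T (p x)
    ∈-filterᵇ⁻ p = ∈-filter⁻ (T? ∘ p)

    unique-filterᵇ : (p : A → Bool) {xs : List A} → Unique xs → Unique (filterᵇ p xs)
    unique-filterᵇ p = Uniq.filter⁺ (T? ∘ p)

    count-∷ : (p : A → Bool) (x : A) (xs : List A) → count p (x ∷ xs) ≡ bit (p x) + count p xs
    count-∷ p x xs with p x
    ... | true = refl
    ... | false = refl

    count-++ : (p : A → Bool) (xs ys : List A) → count p (xs ++ ys) ≡ count p xs + count p ys
    count-++ p xs ys = trans (cong length (filter-++ (T? ∘ p) xs ys)) (length-++ (filterᵇ p xs))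

    count-mono : (p q : A → Bool) (xs : List A) → (∀ x → T (p x) → T (q x)) → count p xs ≤ count q xs
    count-mono p q [] h = z≤n
    count-mono p q (x ∷ xs) h with p x | q x | h x
    ... | false | false | _ = count-mono p q xs h
    ... | false | true | _ = m≤n⇒m≤1+n (count-mono p q xs h)
    ... | true | true | _ = s≤s (count-mono p q xs h)
    ... | true | false | f = ⊥-elim (f tt)

    count-∨ : (p q r : A → Bool) (xs : List A) → (∀ x → T (p x) → T (q x) ⊎ T (r x)) →
      count p xs ≤ count q xs + count r xs
    count-∨ p q r [] h = z≤n
    count-∨ p q r (x ∷ xs) h with p x | q x | r x | h x
    ... | false | false | false | _ = count-∨ p q r xs h
    ... | false | true | false | _ = m≤n⇒m≤1+n (count-∨ p q r xs h)
    ... | false | false | true | _ = ≤-trans (count-∨ p q r xs h) (+-monoʳ-≤ (count q xs) (n≤1+n _))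
    ... | false | true | true | _ = m≤n⇒m≤1+n (≤-trans (count-∨ p q r xs h) (+-monoʳ-≤ (count q xs) (n≤1+n _)))
    ... | true | true | false | _ = s≤s (count-∨ p q r xs h)
    ... | true | true | true | _ = s≤s (≤-trans (count-∨ p q r xs h) (+-monoʳ-≤ (count q xs) (n≤1+n _)))
    ... | true | false | true | _ = ≤-trans (s≤s (count-∨ p q r xs h)) (≤-reflexive (sym (+-suc _ _)))
    ... | true | false | false | f = ⊥-elim ([ id , id ]′ (f tt))

    count-disjoint : (p q r : A → Bool) (xs : List A) → (∀ x → T (p x) → T (r x)) → (∀ x → T (q x) → T (r x)) →
      (∀ x → T (p x) → T (q x) → ⊥) → count p xs + count q xs ≤ count r xs
    count-disjoint p q r [] f g h = z≤n
    count-disjoint p q r (x ∷ xs) f g h with p x | q x | r x | f x | g x | h x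
    ... | false | false | false | _ | _ | _ = count-disjoint p q r xs f g h
    ... | false | false | true | _ | _ | _ = m≤n⇒m≤1+n (count-disjoint p q r xs f g h)
    ... | true | false | true | _ | _ | _ = s≤s (count-disjoint p q r xs f g h)
    ... | false | true | true | _ | _ | _ = ≤-trans (≤-reflexive (+-suc _ _)) (s≤s (count-disjoint p q r xs f g h))
    ... | true | true | _ | _ | _ | e = ⊥-elim (e tt tt)
    ... | true | _ | false | e | _ | _ = ⊥-elim (e tt)
    ... | _ | true | false | _ | e | _ = ⊥-elim (e tt)

    count-true : (xs : List A) → count (λ _ → true) xs ≡ length xs
    count-true [] = refl
    count-true (x ∷ xs) = cong suc (count-true xs)

    count-≤-length : (p : A → Bool) (xs : List A) → count p xs ≤ length xs
    count-≤-length p xs = subst (count p xs ≤_) (count-true xs) (count-mono p (λ _ → true) xs (λ _ _ → tt))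

    count-nest : (p q : A → Bool) (xs : List A) → count q (filterᵇ p xs) ≡ count (λ x → p x ∧ q x) xs
    count-nest p q [] = refl
    count-nest p q (x ∷ xs) with p x
    ... | false = count-nest p q xs
    ... | true with q x
    ...   | true = cong suc (count-nest p q xs)
    ...   | false = count-nest p q xs

    unique-⊆⇒length≤ : {xs ys : List A} → Unique xs → (∀ {x} → x ∈ xs → x ∈ ys) → length xs ≤ length ys
    unique-⊆⇒length≤ [] _ = z≤n
    unique-⊆⇒length≤ {x ∷ xs} (x∉ ∷ u) h with ∈-∃++ (h (here refl))
    ... | us , vs , refl = subst (suc (length xs) ≤_) (sym lem) (s≤s (unique-⊆⇒length≤ u sub))
      where
      lem : length (us ++ x ∷ vs) ≡ suc (length (us ++ vs))
      lem = trans (length-++ us) (trans (+-suc (length us) (length vs)) (cong suc (sym (length-++ us))))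
      sub : ∀ {y} → y ∈ xs → y ∈ us ++ vs
      sub {y} m with ∈-++⁻ us (h (there m))
      ... | inj₁ a = ∈-++⁺ˡ a
      ... | inj₂ (here refl) = ⊥-elim (All.lookup x∉ m refl)
      ... | inj₂ (there b) = ∈-++⁺ʳ us b

    count-≤-list : (p : A → Bool) {xs ys : List A} → Unique xs → (∀ x → T (p x) → x ∈ ys) → count p xs ≤ length ys
    count-≤-list p {xs} u h = unique-⊆⇒length≤ (unique-filterᵇ p u) (λ {x} m → h x (proj₂ (∈-filterᵇ⁻ p {xs = xs} m)))

    sum-mono : (f g : A → ℕ) (xs : List A) → (∀ x → f x ≤ g x) → sum (map f xs) ≤ sum (map g xs)
    sum-mono f g [] h = z≤n
    sum-mono f g (x ∷ xs) h = +-mono-≤ (h x) (sum-mono f g xs h)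

    sum-const-on : (p : A → Bool) (k : ℕ) (f : A → ℕ) (xs : List A) → (∀ x → T (p x) → k ≤ f x) →
      count p xs * k ≤ sum (map f xs)
    sum-const-on p k f [] h = z≤n
    sum-const-on p k f (x ∷ xs) h with p x | h x
    ... | true | g = +-mono-≤ (g tt) (sum-const-on p k f xs h)
    ... | false | _ = ≤-trans (sum-const-on p k f xs h) (m≤n+m _ (f x))

    sum-bound-on : (p : A → Bool) (k : ℕ) (f : A → ℕ) (xs : List A) → (∀ x → T (p x) → f x ≤ k) → (∀ x → ¬ T (p x) → f x ≡ 0) →
      sum (map f xs) ≤ count p xs * k
    sum-bound-on p k f [] h z = z≤n
    sum-bound-on p k f (x ∷ xs) h z with p x | h x | z x
    ... | true | g | _ = +-mono-≤ (g tt) (sum-bound-on p k f xs h z)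
    ... | false | _ | e rewrite e id = sum-bound-on p k f xs h z

    sum-+ : (f g : A → ℕ) (xs : List A) → sum (map (λ x → f x + g x) xs) ≡ sum (map f xs) + sum (map g xs)
    sum-+ f g [] = refl
    sum-+ f g (x ∷ xs) = trans (cong (f x + g x +_) (sum-+ f g xs)) (interchange (f x) (g x) _ _)
      where
      interchange : ∀ a b c d → a + b + (c + d) ≡ a + c + (b + d)
      interchange = solve-∀

    sum-cong : (f g : A → ℕ) (xs : List A) → (∀ x → f x ≡ g x) → sum (map f xs) ≡ sum (map g xs)
    sum-cong f g [] h = refl
    sum-cong f g (x ∷ xs) h = cong₂ _+_ (h x) (sum-cong f g xs h)

    sum-*ʳ : (f : A → ℕ) (k : ℕ) (xs : List A) → sum (map (λ x → f x * k) xs) ≡ sum (map f xs) * k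
    sum-*ʳ f k [] = refl
    sum-*ʳ f k (x ∷ xs) = trans (cong (f x * k +_) (sum-*ʳ f k xs)) (sym (*-distribʳ-+ k (f x) (sum (map f xs))))

    sum-bit : (p : A → Bool) (xs : List A) → sum (map (bit ∘ p) xs) ≡ count p xs
    sum-bit p [] = refl
    sum-bit p (x ∷ xs) = trans (cong (bit (p x) +_) (sum-bit p xs)) (sym (count-∷ p x xs))

    sum-*k : (p : A → Bool) (k : ℕ) (xs : List A) → sum (map (λ x → bit (p x) * k) xs) ≡ count p xs * k
    sum-*k p k xs = trans (sum-*ʳ (bit ∘ p) k xs) (cong (_* k) (sum-bit p xs))

  module _ {A B : Set} where

    count-map : (f : A → B) (p : B → Bool) (xs : List A) → count p (map f xs) ≡ count (p ∘ f) xs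
    count-map f p [] = refl
    count-map f p (x ∷ xs) = trans (count-∷ p (f x) _) (trans (cong (bit (p (f x)) +_) (count-map f p xs)) (sym (count-∷ (p ∘ f) x xs)))

    unique-map-on : (f : A → B) {xs : List A} → Unique xs → (∀ {x y} → x ∈ xs → y ∈ xs → f x ≡ f y → x ≡ y) → Unique (map f xs)
    unique-map-on f [] _ = []
    unique-map-on f {x ∷ xs} (x∉ ∷ u) inj =
      All.tabulate (λ {z} m e → let (y , y∈ , eq) = ∈-map⁻ f m in
        All.lookup x∉ y∈ (inj (here refl) (there y∈) (trans e eq)))
      ∷ unique-map-on f u (λ a b → inj (there a) (there b))

    count-injection : (f : A → B) (p : A → Bool) (q : B → Bool) {xs : List A} {ys : List B} → Unique xs →
      (∀ y → T (q y) → y ∈ ys) → (∀ x → T (p x) → T (q (f x))) →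
      (∀ x y → T (p x) → T (p y) → f x ≡ f y → x ≡ y) → count p xs ≤ count q ys
    count-injection f p q {xs} {ys} u full h inj =
      subst (_≤ count q ys) (length-map f (filterᵇ p xs))
        (unique-⊆⇒length≤ (unique-map-on f (unique-filterᵇ p u) inj′) sub)
      where
      get : ∀ {x} → x ∈ filterᵇ p xs → T (p x)
      get m = proj₂ (∈-filterᵇ⁻ p {xs = xs} m)
      inj′ : ∀ {x y} → x ∈ filterᵇ p xs → y ∈ filterᵇ p xs → f x ≡ f y → x ≡ y
      inj′ a b = inj _ _ (get a) (get b)
      sub : ∀ {y} → y ∈ map f (filterᵇ p xs) → y ∈ filterᵇ q ys
      sub m with ∈-map⁻ f m
      ... | x , x∈ , refl = ∈-filterᵇ⁺ q (full _ (h x (get x∈))) (h x (get x∈))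

  module _ {A B : Set} where

    count-cartesianProduct : (r : A → B → Bool) (xs : List A) (ys : List B) →
      count (uncurry r) (cartesianProduct xs ys) ≡ sum (map (λ x → count (r x) ys) xs)
    count-cartesianProduct r [] ys = refl
    count-cartesianProduct r (x ∷ xs) ys =
      trans (count-++ (uncurry r) (map (x ,_) ys) _)
        (cong₂ _+_ (count-map (x ,_) (uncurry r) ys) (count-cartesianProduct r xs ys))

    count-×-∧ : (p : A → Bool) (r : A → B → Bool) (xs : List A) (ys : List B) →
      count (λ z → p (proj₁ z) ∧ r (proj₁ z) (proj₂ z)) (cartesianProduct xs ys) ≡ sum (map (λ x → bit (p x) * count (r x) ys) xs)
    count-×-∧ p r xs ys = trans (count-cartesianProduct (λ x y → p x ∧ r x y) xs ys) (sum-cong _ _ xs lem)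
      where
      count-false : ∀ zs → count {B} (λ _ → false) zs ≡ 0
      count-false [] = refl
      count-false (z ∷ zs) = count-false zs
      lem : ∀ x → count (λ y → p x ∧ r x y) ys ≡ bit (p x) * count (r x) ys
      lem x with p x
      ... | true = sym (+-identityʳ _)
      ... | false = count-false ys

    count-× : (p : A → Bool) (q : B → Bool) (xs : List A) (ys : List B) →
      count (λ z → p (proj₁ z) ∧ q (proj₂ z)) (cartesianProduct xs ys) ≡ count p xs * count q ys
    count-× p q xs ys = trans (count-×-∧ p (λ _ → q) xs ys) (sum-*k p (count q ys) xs)

  unique-singleton : {A : Set} {x : A} → Unique (x ∷ [])
  unique-singleton = [] ∷ []

  -- The enumeration of matrices, finite quantifiers and quadruples.

  allVecsOf-suc : {A : Set} (xs : List A) (m : ℕ) →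
    allVecsOf xs (suc m) ≡ cartesianProductWith Vec._∷_ xs (allVecsOf xs m)
  allVecsOf-suc {A} xs m = go xs
    where
    go : ∀ ys → concatMap (λ x → map (x Vec.∷_) (allVecsOf xs m)) ys ≡ cartesianProductWith Vec._∷_ ys (allVecsOf xs m)
    go [] = refl
    go (y ∷ ys) = cong (map (y Vec.∷_) (allVecsOf xs m) ++_) (go ys)

  allVecsOf-complete : {A : Set} (xs : List A) → (∀ a → a ∈ xs) → ∀ {m} (v : Vec A m) → v ∈ allVecsOf xs m
  allVecsOf-complete xs full Vec.[] = here refl
  allVecsOf-complete xs full {suc m} (a Vec.∷ v) = subst (a Vec.∷ v ∈_) (sym (allVecsOf-suc xs m))
    (∈-cartesianProductWith⁺ Vec._∷_ (full a) (allVecsOf-complete xs full v))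

  allVecsOf-unique : {A : Set} {xs : List A} → Unique xs → ∀ m → Unique (allVecsOf xs m)
  allVecsOf-unique u zero = unique-singleton
  allVecsOf-unique {xs = xs} u (suc m) = subst Unique (sym (allVecsOf-suc xs m))
    (Uniq.cartesianProductWith⁺ Vec._∷_ VecP.∷-injective u (allVecsOf-unique u m))

  allAdj-complete : ∀ {n} (A : Adj n) → A ∈ allAdj n
  allAdj-complete {n} = allVecsOf-complete _ (allVecsOf-complete _ bools)
    where
    bools : ∀ b → b ∈ true ∷ false ∷ []
    bools true = here refl
    bools false = there (here refl)

  allAdj-unique : ∀ n → Unique (allAdj n)
  allAdj-unique n = allVecsOf-unique (allVecsOf-unique (((λ ()) ∷ []) ∷ unique-singleton) n) n

  countFin≡count : ∀ {n} (p : Fin n → Bool) → countFin p ≡ count p (allFin n)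
  countFin≡count {n} p = go n id
    where
    go : ∀ m (g : Fin m → Fin n) →
      Vec.foldr _ (λ i k → bit (p i) + k) 0 (Vec.tabulate g) ≡ count p (Data.List.tabulate g)
    go zero g = refl
    go (suc m) g = trans (cong (bit (p (g zero)) +_) (go m (g ∘ suc))) (sym (count-∷ p (g zero) _))

  anyFin⁺ : ∀ {n} (p : Fin n → Bool) (i : Fin n) → T (p i) → T (anyFin p)
  anyFin⁺ {n} p i h = go n id i h
    where
    go : ∀ m (g : Fin m → Fin n) (j : Fin m) → T (p (g j)) →
      T (Vec.foldr (λ _ → Bool) (λ i b → p i ∨ b) false (Vec.tabulate g))
    go (suc m) g zero h = T-inl h
    go (suc m) g (suc j) h = T-inr {p (g zero)} (go m (g ∘ suc) j h)

  anyFin⁻ : ∀ {n} (p : Fin n → Bool) → T (anyFin p) → ∃ λ i → T (p i)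
  anyFin⁻ {n} p = go n id
    where
    go : ∀ m (g : Fin m → Fin n) → T (Vec.foldr (λ _ → Bool) (λ i b → p i ∨ b) false (Vec.tabulate g)) → ∃ λ i → T (p i)
    go (suc m) g h with T-cases {p (g zero)} h
    ... | inj₁ a = g zero , a
    ... | inj₂ b = go m (g ∘ suc) b

  allFin?⁺ : ∀ {n} (p : Fin n → Bool) → (∀ i → T (p i)) → T (allFin? p)
  allFin?⁺ {n} p h = go n id
    where
    go : ∀ m (g : Fin m → Fin n) → T (Vec.foldr (λ _ → Bool) (λ i b → p i ∧ b) true (Vec.tabulate g))
    go zero g = tt
    go (suc m) g = T-pair (h (g zero)) (go m (g ∘ suc))

  allFin?⁻ : ∀ {n} (p : Fin n → Bool) → T (allFin? p) → ∀ i → T (p i)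
  allFin?⁻ {n} p h i = go n id i h
    where
    go : ∀ m (g : Fin m → Fin n) (j : Fin m) → T (Vec.foldr (λ _ → Bool) (λ i b → p i ∧ b) true (Vec.tabulate g)) → T (p (g j))
    go (suc m) g zero h = proj₁ (T-split {p (g zero)} h)
    go (suc m) g (suc j) h = go m (g ∘ suc) j (proj₂ (T-split {p (g zero)} h))

  infix 4 _≟ᵇ_
  _≟ᵇ_ : ∀ {n} → Fin n → Fin n → Bool
  i ≟ᵇ j = ⌊ i ≟F j ⌋

  ≟ᵇ⇒≡ : ∀ {n} {i j : Fin n} → T (i ≟ᵇ j) → i ≡ j
  ≟ᵇ⇒≡ {i = i} {j} = toWitness {a? = i ≟F j}

  ≡⇒≟ᵇ : ∀ {n} {i j : Fin n} → i ≡ j → T (i ≟ᵇ j)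
  ≡⇒≟ᵇ {i = i} {j} = fromWitness {a? = i ≟F j}

  pairs : (n : ℕ) → List (Fin n × Fin n)
  pairs n = cartesianProduct (allFin n) (allFin n)

  ∈-pairs : ∀ {n} (x : Fin n × Fin n) → x ∈ pairs n
  ∈-pairs (i , j) = ∈-cartesianProduct⁺ (∈-allFin i) (∈-allFin j)

  pairs-unique : ∀ n → Unique (pairs n)
  pairs-unique n = Uniq.cartesianProduct⁺ (Uniq.allFin⁺ n) (Uniq.allFin⁺ n)

  Quad : ℕ → Set
  Quad n = (Fin n × Fin n) × (Fin n × Fin n)

  quads : (n : ℕ) → List (Quad n)
  quads n = cartesianProduct (pairs n) (pairs n)

  ∈-quads : ∀ {n} (x : Quad n) → x ∈ quads n
  ∈-quads (i , j) = ∈-cartesianProduct⁺ (∈-pairs i) (∈-pairs j)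

  quads-unique : ∀ n → Unique (quads n)
  quads-unique n = Uniq.cartesianProduct⁺ (pairs-unique n) (pairs-unique n)

  vec-ext : ∀ {A : Set} {n} (u v : Vec A n) → (∀ i → lookup u i ≡ lookup v i) → u ≡ v
  vec-ext Vec.[] Vec.[] h = refl
  vec-ext (x Vec.∷ u) (y Vec.∷ v) h = cong₂ Vec._∷_ (h zero) (vec-ext u v (h ∘ suc))

  adj-ext : ∀ {n} (A B : Adj n) → (∀ i j → adj A i j ≡ adj B i j) → A ≡ B
  adj-ext A B h = vec-ext A B (λ i → vec-ext _ _ (h i))

  -- Reachability and components.

  Reach : ∀ {n} → Adj n → Fin n → Fin n → Set
  Reach A v u = T (component A v u)

  module _ {n : ℕ} (A : Adj n) where

    step-∋ : (S : Fin n → Bool) (j : Fin n) → T (S j) → T (step A S j)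
    step-∋ S j = T-inl

    step-next : (S : Fin n → Bool) (i j : Fin n) → T (S i) → T (adj A i j) → T (step A S j)
    step-next S i j s e = T-inr {S j} (anyFin⁺ (λ i → S i ∧ adj A i j) i (T-pair s e))

    step⁻ : (S : Fin n → Bool) (j : Fin n) → T (step A S j) → T (S j) ⊎ ∃ λ i → T (S i) × T (adj A i j)
    step⁻ S j h with T-cases {S j} h
    ... | inj₁ a = inj₁ a
    ... | inj₂ b with anyFin⁻ (λ i → S i ∧ adj A i j) b
    ...   | i , c = inj₂ (i , T-split c)

    reachWithin-elim : (P : Fin n → Set) (v : Fin n) → P v → (∀ i j → P i → T (adj A i j) → P j) →
      ∀ k u → T (reachWithin A k v u) → P u
    reachWithin-elim P v base next zero u h = subst P (≟ᵇ⇒≡ h) base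
    reachWithin-elim P v base next (suc k) u h with step⁻ (reachWithin A k v) u h
    ... | inj₁ a = reachWithin-elim P v base next k u a
    ... | inj₂ (i , a , e) = next i u (reachWithin-elim P v base next k i a) e

    Stable : (Fin n → Bool) → Set
    Stable S = ∀ j → T (step A S j) → T (S j)

    stable-step : ∀ S → Stable S → Stable (step A S)
    stable-step S st j h with step⁻ (step A S) j h
    ... | inj₁ a = a
    ... | inj₂ (i , a , e) = step-next S i j (st i a) e

    stable-or-grows : ∀ S → Stable S ⊎ suc (count S (allFin n)) ≤ count (step A S) (allFin n)
    stable-or-grows S with any? (λ j → T? (step A S j) ×-dec ¬? (T? (S j)))
    ... | no h = inj₁ λ j s → case T? (S j) of λ where
      (yes a) → a
      (no b) → ⊥-elim (h (j , s , b))
    ... | yes (j , s , b) = inj₂ (subst (_≤ count (step A S) (allFin n)) (+-comm (count S (allFin n)) 1)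
      (≤-trans (+-monoʳ-≤ (count S (allFin n)) one) (count-disjoint S (_≟ᵇ j) (step A S) (allFin n) (step-∋ S)
        (λ i e → subst (T ∘ step A S) (sym (≟ᵇ⇒≡ e)) s) (λ i a e → b (subst (T ∘ S) (≟ᵇ⇒≡ e) a)))))
      where
      one : 1 ≤ count (_≟ᵇ j) (allFin n)
      one = unique-⊆⇒length≤ (unique-singleton {x = j}) λ where
        (here refl) → ∈-filterᵇ⁺ (_≟ᵇ j) (∈-allFin j) (≡⇒≟ᵇ refl)

    -- While the reached set is not closed under adjacency, every round adds a vertex. After `n`
    -- rounds the second alternative exceeds the number of vertices, so truncating walks at length
    -- `n` loses nothing.
    stable-or-large : ∀ v k → Stable (reachWithin A k v) ⊎ suc k ≤ count (reachWithin A k v) (allFin n)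
    stable-or-large v zero = inj₂ (unique-⊆⇒length≤ (unique-singleton {x = v}) λ where
        (here refl) → ∈-filterᵇ⁺ (reachWithin A 0 v) (∈-allFin v) (≡⇒≟ᵇ {i = v} refl))
    stable-or-large v (suc k) with stable-or-large v k
    ... | inj₁ st = inj₁ (stable-step _ st)
    ... | inj₂ le with stable-or-grows (reachWithin A k v)
    ...   | inj₁ st = inj₁ (stable-step _ st)
    ...   | inj₂ gr = inj₂ (≤-trans (s≤s le) gr)

    component-stable : ∀ v → Stable (component A v)
    component-stable v with stable-or-large v n
    ... | inj₁ st = st
    ... | inj₂ le = ⊥-elim (<-irrefl refl (≤-trans le (≤-trans (count-≤-length (component A v) (allFin n)) (≤-reflexive (length-tabulate id)))))

    reach-refl : ∀ v → Reach A v v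
    reach-refl v = go n
      where
      go : ∀ k → T (reachWithin A k v v)
      go zero = ≡⇒≟ᵇ {i = v} refl
      go (suc k) = step-∋ (reachWithin A k v) v (go k)

    reach-snoc : ∀ {v i j} → Reach A v i → T (adj A i j) → Reach A v j
    reach-snoc {v} {i} {j} r e = component-stable v j (step-next (component A v) i j r e)

    reach-elim : (P : Fin n → Set) {v : Fin n} → P v → (∀ i j → P i → T (adj A i j) → P j) → ∀ {u} → Reach A v u → P u
    reach-elim P {v} base next {u} = reachWithin-elim P v base next n u

    reach-edge : ∀ {i j} → T (adj A i j) → Reach A i j
    reach-edge {i} = reach-snoc (reach-refl i)

    reach-trans : ∀ {i j k} → Reach A i j → Reach A j k → Reach A i k
    reach-trans {i} r = reach-elim (Reach A i) r (λ _ _ → reach-snoc)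

    reach-sym : (∀ i j → T (adj A i j) → T (adj A j i)) → ∀ {i j} → Reach A i j → Reach A j i
    reach-sym s {i} = reach-elim (λ u → Reach A u i) (reach-refl i) (λ u w r e → reach-trans (reach-edge (s u w e)) r)

  -- Graphs with given degrees, in propositional form.

  size : ∀ {n} → (Fin n → Bool) → ℕ
  size {n} p = count p (allFin n)

  size≤n : ∀ {n} (p : Fin n → Bool) → size p ≤ n
  size≤n {n} p = ≤-trans (count-≤-length p (allFin n)) (≤-reflexive (length-tabulate id))

  T-dec : ∀ {A : Set} (b : Bool) → (T b → A) → (¬ T b → A) → A
  T-dec true f g = f tt
  T-dec false f g = g id

  E : ∀ {n} → Adj n → Fin n → Fin n → Set
  E A i j = T (adj A i j)

  record IsGraph {n : ℕ} (d : Vec ℕ n) (A : Adj n) : Set where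
    field
      flip : ∀ i j → E A i j → E A j i
      irr : ∀ i → ¬ E A i i
      deg : ∀ i → size (adj A i) ≡ lookup d i

  isGraph : ∀ {n} → Vec ℕ n → Adj n → Bool
  isGraph d A = isSimple A ∧ hasDegrees A d

  ==⇒T : ∀ x y → T (x == y) → T x → T y
  ==⇒T true true _ _ = tt

  T⇒== : ∀ x y → (T x → T y) → (T y → T x) → T (x == y)
  T⇒== false false _ _ = tt
  T⇒== false true _ g = g tt
  T⇒== true true _ _ = tt
  T⇒== true false f _ = f tt

  isGraph⇒ : ∀ {n} (d : Vec ℕ n) (A : Adj n) → T (isGraph d A) → IsGraph d A
  isGraph⇒ d A h = record { flip = fl ; irr = λ i → not-T (proj₁ (row i)) ; deg = dg }
    where
    split = T-split {isSimple A} h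
    row : ∀ i → T (not (adj A i i)) × T (allFin? (λ j → adj A i j == adj A j i))
    row i = T-split (allFin?⁻ (λ i → not (adj A i i) ∧ allFin? (λ j → adj A i j == adj A j i)) (proj₁ split) i)
    fl : ∀ i j → E A i j → E A j i
    fl i j = ==⇒T _ _ (allFin?⁻ (λ j → adj A i j == adj A j i) (proj₂ (row i)) j)
    dg : ∀ i → size (adj A i) ≡ lookup d i
    dg i = trans (sym (countFin≡count (adj A i)))
      (≡ᵇ⇒≡ _ _ (allFin?⁻ (λ i → degree A i ≡ᵇ lookup d i) (proj₂ split) i))

  ⇒isGraph : ∀ {n} (d : Vec ℕ n) (A : Adj n) → IsGraph d A → T (isGraph d A)
  ⇒isGraph d A g = T-pair
    (allFin?⁺ (λ i → not (adj A i i) ∧ allFin? (λ j → adj A i j == adj A j i)) (λ i → T-pair (T-not (irr i))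
      (allFin?⁺ (λ j → adj A i j == adj A j i) (λ j → T⇒== _ _ (flip i j) (flip j i)))))
    (allFin?⁺ (λ i → degree A i ≡ᵇ lookup d i) (λ i → ≡⇒≡ᵇ _ _ (trans (countFin≡count (adj A i)) (deg i))))
    where open IsGraph g

  -- The 2-switch and its symmetries.

  Same : ∀ {n} (p q i j : Fin n) → Set
  Same p q i j = (i ≡ p × j ≡ q) ⊎ (i ≡ q × j ≡ p)

  same : ∀ {n} (p q i j : Fin n) → Bool
  same p q i j = ((i ≟ᵇ p) ∧ (j ≟ᵇ q)) ∨ ((i ≟ᵇ q) ∧ (j ≟ᵇ p))

  same⇒ : ∀ {n} (p q i j : Fin n) → T (same p q i j) → Same p q i j
  same⇒ p q i j h with T-cases {(i ≟ᵇ p) ∧ (j ≟ᵇ q)} h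
  ... | inj₁ a = let (x , y) = T-split {i ≟ᵇ p} a in inj₁ (≟ᵇ⇒≡ x , ≟ᵇ⇒≡ y)
  ... | inj₂ a = let (x , y) = T-split {i ≟ᵇ q} a in inj₂ (≟ᵇ⇒≡ x , ≟ᵇ⇒≡ y)

  ⇒same : ∀ {n} (p q i j : Fin n) → Same p q i j → T (same p q i j)
  ⇒same p q i j (inj₁ (x , y)) = T-inl (T-pair (≡⇒≟ᵇ x) (≡⇒≟ᵇ y))
  ⇒same p q i j (inj₂ (x , y)) = T-inr {(i ≟ᵇ p) ∧ (j ≟ᵇ q)} (T-pair (≡⇒≟ᵇ x) (≡⇒≟ᵇ y))

  Same-flip : ∀ {n} {p q i j : Fin n} → Same p q i j → Same p q j i
  Same-flip (inj₁ (x , y)) = inj₂ (y , x)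
  Same-flip (inj₂ (x , y)) = inj₁ (y , x)

  Same-turn : ∀ {n} {p q i j : Fin n} → Same p q i j → Same q p i j
  Same-turn (inj₁ x) = inj₂ x
  Same-turn (inj₂ x) = inj₁ x

  mask : ∀ {n} (p q r s i j : Fin n) → Bool
  mask p q r s i j = (same p q i j ∨ same r s i j) ∨ (same p r i j ∨ same q s i j)

  -- On a valid quadruple this deletes pq, rs and inserts pr, qs; toggling makes it injective in A for every quadruple.
  switch : ∀ {n} (p q r s : Fin n) → Adj n → Adj n
  switch p q r s A = Vec.tabulate λ i → Vec.tabulate λ j → adj A i j xor mask p q r s i j

  adj-switch : ∀ {n} (p q r s : Fin n) (A : Adj n) i j → adj (switch p q r s A) i j ≡ adj A i j xor mask p q r s i j
  adj-switch p q r s A i j = trans (cong (λ v → lookup v j) (VecP.lookup∘tabulate (λ i → Vec.tabulate λ j → adj A i j xor mask p q r s i j) i))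
    (VecP.lookup∘tabulate (λ j → adj A i j xor mask p q r s i j) j)

  xor-cancelʳ : ∀ m {a b} → a xor m ≡ b xor m → a ≡ b
  xor-cancelʳ m {false} {false} _ = refl
  xor-cancelʳ m {true} {true} _ = refl
  xor-cancelʳ true {false} {true} ()
  xor-cancelʳ false {false} {true} ()
  xor-cancelʳ true {true} {false} ()
  xor-cancelʳ false {true} {false} ()

  switch-injective : ∀ {n} (p q r s : Fin n) (A B : Adj n) → switch p q r s A ≡ switch p q r s B → A ≡ B
  switch-injective p q r s A B eq = adj-ext A B λ i j → xor-cancelʳ (mask p q r s i j)
    (trans (sym (adj-switch p q r s A i j)) (trans (cong (λ C → adj C i j) eq) (adj-switch p q r s B i j)))

  -- Describes a switch by its effect on edges. The description is symmetric under exchanging the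
  -- two graphs together with `q` and `r`, so what is proved for a switch also holds for its
  -- reversal.
  record Switched {n : ℕ} (A B : Adj n) (p q r s : Fin n) : Set where
    field
      rem₁ : E A p q
      rem₂ : E A r s
      add₁ : E B p r
      add₂ : E B q s
      p≢q : p ≢ q
      p≢r : p ≢ r
      p≢s : p ≢ s
      q≢r : q ≢ r
      q≢s : q ≢ s
      r≢s : r ≢ s
      fwd : ∀ i j → E B i j → (E A i j × ¬ Same p q i j × ¬ Same r s i j) ⊎ (Same p r i j ⊎ Same q s i j)
      bwd : ∀ i j → E A i j → (E B i j × ¬ Same p r i j × ¬ Same q s i j) ⊎ (Same p q i j ⊎ Same r s i j)

  record Valid {n : ℕ} (A : Adj n) (p q r s : Fin n) : Set where
    field
      pq : E A p q
      rs : E A r s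
      ¬pr : ¬ E A p r
      ¬qs : ¬ E A q s
      p≢r : p ≢ r
      q≢s : q ≢ s

  count-swap : ∀ {n} (f g : Fin n → Bool) (q r : Fin n) → T (f q) →
    (∀ j → T (g j) → j ≡ r ⊎ (T (f j) × j ≢ q)) → size g ≤ size f
  count-swap {n} f g q r fq h = begin
    size g ≤⟨ count-∨ g f′ (_≟ᵇ r) (allFin n) step₁ ⟩
    size f′ + size (_≟ᵇ r) ≤⟨ +-monoʳ-≤ (size f′) (count-≤-list (_≟ᵇ r) {ys = r ∷ []} (Uniq.allFin⁺ n) (λ x e → here (≟ᵇ⇒≡ e))) ⟩
    size f′ + 1 ≤⟨ +-monoʳ-≤ (size f′) one ⟩
    size f′ + size (_≟ᵇ q) ≤⟨ count-disjoint f′ (_≟ᵇ q) f (allFin n) (λ x e → proj₁ (T-split {f x} e))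
       (λ x e → subst (T ∘ f) (sym (≟ᵇ⇒≡ e)) fq) (λ x a e → not-T (proj₂ (T-split {f x} a)) e) ⟩
    size f ∎
    where
    open ≤-Reasoning
    f′ : Fin n → Bool
    f′ j = f j ∧ not (j ≟ᵇ q)
    step₁ : ∀ j → T (g j) → T (f′ j) ⊎ T (j ≟ᵇ r)
    step₁ j gj with h j gj
    ... | inj₁ e = inj₂ (≡⇒≟ᵇ e)
    ... | inj₂ (a , b) = inj₁ (T-pair a (T-not (b ∘ ≟ᵇ⇒≡)))
    one : 1 ≤ size (_≟ᵇ q)
    one = unique-⊆⇒length≤ (unique-singleton {x = q}) λ where
      (here refl) → ∈-filterᵇ⁺ (_≟ᵇ q) (∈-allFin q) (≡⇒≟ᵇ refl)

  module _ {n : ℕ} {A B : Adj n} (flipA : ∀ i j → E A i j → E A j i) (flipB : ∀ i j → E B i j → E B j i) where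

    switched-turn : ∀ {p q r s} → Switched A B p q r s → Switched A B q p s r
    switched-turn sw = record
      { rem₁ = flipA _ _ rem₁ ; rem₂ = flipA _ _ rem₂ ; add₁ = add₂ ; add₂ = add₁
      ; p≢q = p≢q ∘ sym ; p≢r = q≢s ; p≢s = q≢r ; q≢r = p≢s ; q≢s = p≢r ; r≢s = r≢s ∘ sym
      ; fwd = λ i j e → [ (λ (a , b , c) → inj₁ (a , b ∘ Same-turn , c ∘ Same-turn)) , inj₂ ∘ [ inj₂ , inj₁ ]′ ]′ (fwd i j e)
      ; bwd = λ i j e → [ (λ (a , b , c) → inj₁ (a , c , b)) , inj₂ ∘ [ inj₁ ∘ Same-turn , inj₂ ∘ Same-turn ]′ ]′ (bwd i j e) }
      where open Switched sw

    switched-exchange : ∀ {p q r s} → Switched A B p q r s → Switched A B r s p q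
    switched-exchange sw = record
      { rem₁ = rem₂ ; rem₂ = rem₁ ; add₁ = flipB _ _ add₁ ; add₂ = flipB _ _ add₂
      ; p≢q = r≢s ; p≢r = p≢r ∘ sym ; p≢s = q≢r ∘ sym ; q≢r = p≢s ∘ sym ; q≢s = q≢s ∘ sym ; r≢s = p≢q
      ; fwd = λ i j e → [ (λ (a , b , c) → inj₁ (a , c , b)) , inj₂ ∘ [ inj₁ ∘ Same-turn , inj₂ ∘ Same-turn ]′ ]′ (fwd i j e)
      ; bwd = λ i j e → [ (λ (a , b , c) → inj₁ (a , b ∘ Same-turn , c ∘ Same-turn)) , inj₂ ∘ [ inj₂ , inj₁ ]′ ]′ (bwd i j e) }
      where open Switched sw

    degree-first : ∀ {p q r s} → Switched A B p q r s → size (adj B p) ≤ size (adj A p)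
    degree-first {p} {q} {r} {s} sw = count-swap (adj A p) (adj B p) q r rem₁ λ j e → go j (fwd p j e)
      where
      open Switched sw
      go : ∀ j → (E A p j × ¬ Same p q p j × ¬ Same r s p j) ⊎ (Same p r p j ⊎ Same q s p j) → j ≡ r ⊎ (E A p j × j ≢ q)
      go j (inj₁ (a , b , c)) = inj₂ (a , λ e → b (inj₁ (refl , e)))
      go j (inj₂ (inj₁ (inj₁ (_ , e)))) = inj₁ e
      go j (inj₂ (inj₁ (inj₂ (e , _)))) = ⊥-elim (p≢r e)
      go j (inj₂ (inj₂ (inj₁ (e , _)))) = ⊥-elim (p≢q e)
      go j (inj₂ (inj₂ (inj₂ (e , _)))) = ⊥-elim (p≢s e)

    -- The symmetries of a switch carry each of its four vertices to the first position, so only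
    -- that one has to be computed. Equality of degrees comes from applying the inequality to the
    -- reversed switch as well.
    degree-≤ : ∀ {p q r s} → Switched A B p q r s → ∀ i → size (adj B i) ≤ size (adj A i)
    degree-≤ {p} {q} {r} {s} sw i with i ≟F p | i ≟F q | i ≟F r | i ≟F s
    ... | yes refl | _ | _ | _ = degree-first sw
    ... | no _ | yes refl | _ | _ = degree-first (switched-turn sw)
    ... | no _ | no _ | yes refl | _ = degree-first (switched-exchange sw)
    ... | no _ | no _ | no _ | yes refl = degree-first (switched-turn (switched-exchange sw))
    ... | no a | no b | no c | no e = count-mono (adj B i) (adj A i) (allFin n) λ j x → go j (fwd i j x)
      where
      open Switched sw
      go : ∀ j → (E A i j × ¬ Same p q i j × ¬ Same r s i j) ⊎ (Same p r i j ⊎ Same q s i j) → E A i j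
      go j (inj₁ (x , _)) = x
      go j (inj₂ (inj₁ (inj₁ (x , _)))) = ⊥-elim (a x)
      go j (inj₂ (inj₁ (inj₂ (x , _)))) = ⊥-elim (c x)
      go j (inj₂ (inj₂ (inj₁ (x , _)))) = ⊥-elim (b x)
      go j (inj₂ (inj₂ (inj₂ (x , _)))) = ⊥-elim (e x)

  switched-reverse : ∀ {n} {A B : Adj n} {p q r s} → Switched A B p q r s → Switched B A p r q s
  switched-reverse sw = record
    { rem₁ = add₁ ; rem₂ = add₂ ; add₁ = rem₁ ; add₂ = rem₂
    ; p≢q = p≢r ; p≢r = p≢q ; p≢s = p≢s ; q≢r = q≢r ∘ sym ; q≢s = r≢s ; r≢s = q≢s ; fwd = bwd ; bwd = fwd }
    where open Switched sw

  module _ {n : ℕ} {d : Vec ℕ n} {A : Adj n} (g : IsGraph d A) {p q r s : Fin n} (v : Valid A p q r s) where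

    open IsGraph g
    open Valid v

    private
      B : Adj n
      B = switch p q r s A

      E-Same : ∀ {a b i j} → Same a b i j → E A i j → E A a b
      E-Same (inj₁ (refl , refl)) e = e
      E-Same (inj₂ (refl , refl)) e = flip _ _ e

      E-Same′ : ∀ {a b i j} → Same a b i j → E A a b → E A i j
      E-Same′ (inj₁ (refl , refl)) e = e
      E-Same′ (inj₂ (refl , refl)) e = flip _ _ e

      mask⁻ : ∀ i j → T (mask p q r s i j) → (Same p q i j ⊎ Same r s i j) ⊎ (Same p r i j ⊎ Same q s i j)
      mask⁻ i j m with T-cases {same p q i j ∨ same r s i j} m
      ... | inj₁ a = inj₁ ([ inj₁ ∘ same⇒ p q i j , inj₂ ∘ same⇒ r s i j ]′ (T-cases {same p q i j} a))
      ... | inj₂ a = inj₂ ([ inj₁ ∘ same⇒ p r i j , inj₂ ∘ same⇒ q s i j ]′ (T-cases {same p r i j} a))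

      mask⁺ : ∀ i j → (Same p q i j ⊎ Same r s i j) ⊎ (Same p r i j ⊎ Same q s i j) → T (mask p q r s i j)
      mask⁺ i j (inj₁ (inj₁ x)) = T-inl (T-inl (⇒same p q i j x))
      mask⁺ i j (inj₁ (inj₂ x)) = T-inl (T-inr {same p q i j} (⇒same r s i j x))
      mask⁺ i j (inj₂ (inj₁ x)) = T-inr {same p q i j ∨ same r s i j} (T-inl (⇒same p r i j x))
      mask⁺ i j (inj₂ (inj₂ x)) = T-inr {same p q i j ∨ same r s i j} (T-inr {same p r i j} (⇒same q s i j x))

      xor-T : ∀ a m → T (a xor m) → (T a × ¬ T m) ⊎ (¬ T a × T m)
      xor-T true false _ = inj₁ (tt , id)
      xor-T false true _ = inj₂ (id , tt)

      T-xor : ∀ a m → (T a × ¬ T m) ⊎ (¬ T a × T m) → T (a xor m)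
      T-xor false true _ = tt
      T-xor true false _ = tt
      T-xor true true (inj₁ (_ , f)) = f tt
      T-xor true true (inj₂ (f , _)) = f tt
      T-xor false false (inj₁ (x , _)) = x
      T-xor false false (inj₂ (_ , x)) = x

      toB : ∀ {i j} → (E A i j × ¬ T (mask p q r s i j)) ⊎ (¬ E A i j × T (mask p q r s i j)) → E B i j
      toB {i} {j} h = subst T (sym (adj-switch p q r s A i j)) (T-xor _ _ h)

      fromB : ∀ {i j} → E B i j → (E A i j × ¬ T (mask p q r s i j)) ⊎ (¬ E A i j × T (mask p q r s i j))
      fromB {i} {j} h = xor-T _ _ (subst T (adj-switch p q r s A i j) h)

      flip-mask : ∀ i j → T (mask p q r s i j) → T (mask p q r s j i)
      flip-mask i j m = mask⁺ j i ([ inj₁ ∘ [ inj₁ ∘ Same-flip , inj₂ ∘ Same-flip ]′ , inj₂ ∘ [ inj₁ ∘ Same-flip , inj₂ ∘ Same-flip ]′ ]′ (mask⁻ i j m))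

      flipB : ∀ i j → E B i j → E B j i
      flipB i j e with fromB e
      ... | inj₁ (a , m) = toB (inj₁ (flip i j a , λ m′ → m (flip-mask j i m′)))
      ... | inj₂ (a , m) = toB (inj₂ ((λ a′ → a (flip j i a′)) , flip-mask i j m))

    switch-switched : Switched A B p q r s
    switch-switched = record
      { rem₁ = pq ; rem₂ = rs
      ; add₁ = toB (inj₂ (¬pr , mask⁺ p r (inj₂ (inj₁ (inj₁ (refl , refl))))))
      ; add₂ = toB (inj₂ (¬qs , mask⁺ q s (inj₂ (inj₂ (inj₁ (refl , refl))))))
      ; p≢q = λ { refl → irr p pq }
      ; p≢r = p≢r
      -- This is no part of validity: if `p` were `s`, the edge `rs` would be the non-edge `pr`.
      -- Likewise, `q` equal to `r` would turn the edge `pq` into `pr`.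
      ; p≢s = λ { refl → ¬pr (flip _ _ rs) }
      ; q≢r = λ { refl → ¬pr pq }
      ; q≢s = q≢s
      ; r≢s = λ { refl → irr r rs }
      ; fwd = λ i j e → fw i j (fromB e)
      ; bwd = bw }
      where
      fw : ∀ i j → (E A i j × ¬ T (mask p q r s i j)) ⊎ (¬ E A i j × T (mask p q r s i j)) →
        (E A i j × ¬ Same p q i j × ¬ Same r s i j) ⊎ (Same p r i j ⊎ Same q s i j)
      fw i j (inj₁ (a , m)) = inj₁ (a , (λ x → m (mask⁺ i j (inj₁ (inj₁ x)))) , λ x → m (mask⁺ i j (inj₁ (inj₂ x))))
      fw i j (inj₂ (a , m)) with mask⁻ i j m
      ... | inj₁ (inj₁ x) = ⊥-elim (a (E-Same′ x pq))
      ... | inj₁ (inj₂ x) = ⊥-elim (a (E-Same′ x rs))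
      ... | inj₂ y = inj₂ y
      bw : ∀ i j → E A i j → (E B i j × ¬ Same p r i j × ¬ Same q s i j) ⊎ (Same p q i j ⊎ Same r s i j)
      bw i j e with T? (mask p q r s i j)
      ... | no m = inj₁ (toB (inj₁ (e , m)) , (λ x → m (mask⁺ i j (inj₂ (inj₁ x)))) , λ x → m (mask⁺ i j (inj₂ (inj₂ x))))
      ... | yes m with mask⁻ i j m
      ...   | inj₁ y = inj₂ y
      ...   | inj₂ (inj₁ x) = ⊥-elim (¬pr (E-Same x e))
      ...   | inj₂ (inj₂ x) = ⊥-elim (¬qs (E-Same x e))

    switch-isGraph : IsGraph d B
    switch-isGraph = record
      { flip = flipB
      ; irr = λ i e → case Switched.fwd switch-switched i i e of λ where
          (inj₁ (a , _)) → irr i a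
          (inj₂ (inj₁ (inj₁ (refl , x)))) → p≢r x
          (inj₂ (inj₁ (inj₂ (refl , x)))) → p≢r (sym x)
          (inj₂ (inj₂ (inj₁ (refl , x)))) → q≢s x
          (inj₂ (inj₂ (inj₂ (refl , x)))) → q≢s (sym x)
      ; deg = λ i → trans (≤-antisym (degree-≤ flip flipB switch-switched i)
          (degree-≤ flipB flip (switched-reverse switch-switched) i)) (deg i) }

  size-witness : ∀ {n} (p : Fin n → Bool) → 1 ≤ size p → ∃ λ i → T (p i)
  size-witness {n} p le with any? (λ i → T? (p i))
  ... | yes w = w
  ... | no h = ⊥-elim (<-irrefl refl (≤-trans le (count-≤-list p {ys = []} (Uniq.allFin⁺ n) (λ x e → ⊥-elim (h (x , e))))))

  -- Walks through vertices of degree 2.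

  module Walks {n : ℕ} {d : Vec ℕ n} {A : Adj n} (g : IsGraph d A) where

    open IsGraph g

    Two : Fin n → Set
    Two i = lookup d i ≡ 2

    neighbours-of-two : ∀ {c x y a} → Two c → E A c x → E A c y → x ≢ y → E A c a → a ≡ x ⊎ a ≡ y
    neighbours-of-two {c} {x} {y} {a} two ex ey x≢y ea with a ≟F x | a ≟F y
    ... | yes e | _ = inj₁ e
    ... | no _ | yes e = inj₂ e
    ... | no a≢x | no a≢y = ⊥-elim (<-irrefl refl (≤-trans three (≤-reflexive (trans (deg c) two))))
      where
      three : 3 ≤ size (adj A c)
      three = unique-⊆⇒length≤ {xs = a ∷ x ∷ y ∷ []} ((a≢x ∷ a≢y ∷ []) ∷ (x≢y ∷ []) ∷ unique-singleton) λ where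
        (here refl) → ∈-filterᵇ⁺ (adj A c) (∈-allFin _) ea
        (there (here refl)) → ∈-filterᵇ⁺ (adj A c) (∈-allFin _) ex
        (there (there (here refl))) → ∈-filterᵇ⁺ (adj A c) (∈-allFin _) ey

    another? : ∀ p c → Dec (∃ λ o → E A c o × o ≢ p)
    another? p c = any? (λ o → T? (adj A c o) ×-dec ¬? (o ≟F p))

    -- Falls back to p when p is the only neighbour of c.
    other : Fin n → Fin n → Fin n
    other p c with another? p c
    ... | yes (o , _) = o
    ... | no _ = p

    other-edge : ∀ {p c} → E A c p → E A c (other p c)
    other-edge {p} {c} e with another? p c
    ... | yes (o , e′ , _) = e′
    ... | no _ = e

    other-≢ : ∀ {p c} → Two c → other p c ≢ p
    other-≢ {p} {c} two with another? p c
    ... | yes (o , _ , ne) = ne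
    ... | no h = λ _ → <-irrefl refl (≤-trans (≤-reflexive (trans (sym two) (sym (deg c))))
        (count-≤-list (adj A c) {ys = p ∷ []} (Uniq.allFin⁺ n) lem))
      where
      lem : ∀ x → E A c x → x ∈ p ∷ []
      lem x e with x ≟F p
      ... | yes x≡p = here x≡p
      ... | no x≢p = ⊥-elim (h (x , e , x≢p))

    next : Fin n × Fin n → Fin n × Fin n
    next (p , c) = c , other p c

    module Walk (x₀ x₁ : Fin n) (start : E A x₀ x₁) where

      -- Pairs of consecutive vertices are iterated because the next vertex depends on where the
      -- walk came from.
      dart : ℕ → Fin n × Fin n
      dart zero = x₀ , x₁
      dart (suc i) = next (dart i)

      x : ℕ → Fin n
      x i = proj₁ (dart i)

      walk-edge : ∀ i → E A (x i) (x (suc i))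
      walk-edge zero = start
      walk-edge (suc i) = other-edge (flip _ _ (walk-edge i))

      walk-reach : ∀ i → Reach A x₀ (x i)
      walk-reach zero = reach-refl A x₀
      walk-reach (suc i) = reach-snoc A (walk-reach i) (walk-edge i)

      no-backtrack : ∀ i → Two (x (suc i)) → x (suc (suc i)) ≢ x i
      no-backtrack i = other-≢

      walk-neighbours : ∀ i {a} → Two (x (suc i)) → E A (x (suc i)) a → a ≡ x i ⊎ a ≡ x (suc (suc i))
      walk-neighbours i two = neighbours-of-two two (flip _ _ (walk-edge i)) (walk-edge (suc i)) (no-backtrack i two ∘ sym)

      Injective≤ : ℕ → Set
      Injective≤ k = ∀ {i j} → i < j → j ≤ k → x i ≢ x j

      injective≤ : ∀ {k} → Injective≤ k → ∀ {i j} → i ≤ k → j ≤ k → x i ≡ x j → i ≡ j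
      injective≤ inj {i} {j} hi hj e with <-cmp i j
      ... | tri< lt _ _ = ⊥-elim (inj lt hj e)
      ... | tri≈ _ eq _ = eq
      ... | tri> _ _ gt = ⊥-elim (inj gt hi (sym e))

      -- The vertices up to position `j` form a cycle of length `j + 1`, at least 3. The bound
      -- `j < k` keeps it inside the stretch where the degrees are known to be 2.
      Closes : ℕ → Set
      Closes k = ∃ λ j → 2 ≤ j × j < k × Injective≤ j × x (suc j) ≡ x 0

      -- The first repetition can only be a return to the start: both neighbours of an earlier
      -- interior vertex of degree 2 are its predecessor and successor on the walk, so the walk has
      -- no free edge by which to enter it again.
      injective-or-closes : ∀ k → (∀ i → i ≤ k → Two (x i)) → Injective≤ k ⊎ Closes k
      injective-or-closes zero _ = inj₁ λ { {j = zero} () _ }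
      injective-or-closes (suc k) two with injective-or-closes k (λ i h → two i (m≤n⇒m≤1+n h))
      ... | inj₂ (j , a , b , c) = inj₂ (j , a , m≤n⇒m≤1+n b , c)
      ... | inj₁ inj with x (suc k) ≟F x 0
      ...   | yes e = inj₂ (k , long k e , n<1+n k , inj , e)
        where
        -- A return after one step would be a loop, after two steps a backtrack.
        long : ∀ m → {{_ : m ≡ k}} → x (suc m) ≡ x 0 → 2 ≤ m
        long zero e = ⊥-elim (irr _ (subst (E A (x 0)) e (walk-edge 0)))
        long (suc zero) {{refl}} e = ⊥-elim (no-backtrack 0 (two 1 (s≤s z≤n)) e)
        long (suc (suc m)) e = s≤s (s≤s z≤n)
      ...   | no ne = inj₁ λ {i} {j} i<j j≤ → go i j i<j (m≤n⇒m<n∨m≡n j≤)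
        where
        -- Here `x k` is a neighbour of `x (suc i)`, hence equal to `x i` or `x (2 + i)`.
        -- Injectivity leaves only `k` equal to `2 + i`, a backtrack, and `k` equal to `1 + i`, a
        -- loop.
        new : ∀ i → suc i ≤ k → x (suc i) ≢ x (suc k)
        new i i<k e with walk-neighbours i (two (suc i) (m≤n⇒m≤1+n i<k)) (subst (λ z → E A z (x k)) (sym e) (flip _ _ (walk-edge k)))
        ... | inj₁ a = inj i<k ≤-refl (sym a)
        ... | inj₂ a with <-cmp (suc (suc i)) k
        ...   | tri< lt _ _ = inj lt ≤-refl (sym a)
        ...   | tri≈ _ refl _ = no-backtrack (suc i) (two (suc (suc i)) (n≤1+n _)) (sym e)
        ...   | tri> _ _ (s≤s gt) with ≤-antisym i<k gt
        ...     | refl = irr _ (subst (E A (x k)) (sym e) (walk-edge k))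
        go : ∀ i j → i < j → j < suc k ⊎ j ≡ suc k → x i ≢ x j
        go i j lt (inj₁ (s≤s h)) = inj lt h
        go zero _ lt (inj₂ refl) e = ne (sym e)
        go (suc i) _ (s≤s lt) (inj₂ refl) = new i lt

      -- Each vertex of the cycle has degree 2 and both its neighbours on the cycle, so no edge
      -- leaves it.
      closed-component : ∀ {k} → (∀ i → i ≤ k → Two (x i)) → ((j , _) : Closes k) →
        ∀ {u} → Reach A x₀ u → ∃ λ i → i ≤ j × u ≡ x i
      closed-component {k} two (j , 2≤j , j<k , inj , e) = reach-elim A (λ u → ∃ λ i → i ≤ j × u ≡ x i) (0 , z≤n , refl) stp
        where
        stp : ∀ u w → (∃ λ i → i ≤ j × u ≡ x i) → E A u w → ∃ λ i → i ≤ j × w ≡ x i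
        stp u w (zero , _ , refl) uw with neighbours-of-two (two 0 z≤n) (walk-edge 0)
            (flip _ _ (subst (E A (x j)) e (walk-edge j))) (inj 2≤j ≤-refl) uw
        ... | inj₁ a = 1 , ≤-trans (n≤1+n 1) 2≤j , a
        ... | inj₂ a = j , ≤-refl , a
        stp u w (suc i , i≤j , refl) uw with walk-neighbours i (two (suc i) (≤-trans i≤j (<⇒≤ j<k))) uw
        ... | inj₁ a = i , ≤-trans (n≤1+n i) i≤j , a
        ... | inj₂ a with m≤n⇒m<n∨m≡n i≤j
        ...   | inj₁ lt = suc (suc i) , lt , a
        ...   | inj₂ refl = 0 , z≤n , trans a e

    -- Merging a cycle into another component.

    module Merge {a b y z : Fin n} (ab : E A a b) (zy : E A z y)
      (cyclic : ∀ u → Reach A y u → Two u) (apart : ¬ Reach A y a) where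

      private
        reach-flip : ∀ {i j} → Reach A i j → Reach A j i
        reach-flip = reach-sym A flip

        y⇝z : Reach A y z
        y⇝z = reach-edge A (flip _ _ zy)

      merge-valid : Valid A a b z y
      merge-valid = record
        { pq = ab ; rs = zy
        ; ¬pr = λ e → apart (reach-snoc A y⇝z (flip _ _ e))
        ; ¬qs = λ e → apart (reach-snoc A (reach-edge A (flip _ _ e)) (flip _ _ ab))
        ; p≢r = λ { refl → apart y⇝z }
        ; q≢s = λ { refl → apart (reach-edge A (flip _ _ ab)) } }

      module _ {B : Adj n} (flipB : ∀ i j → E B i j → E B j i) (sw : Switched A B a b z y) where

        open Switched sw

        private
          -- Away from zy the cycle through zy survives, so its two ends stay connected.
          z⇝y : Reach B z y
          z⇝y with injective-or-closes n (λ i _ → cyclic _ (walk-reach i))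
            where open Walk y z (flip _ _ zy)
          ... | inj₁ inj = let (i , j , i<j , e) = pigeonhole (n<1+n n) (λ (i : Fin (suc n)) → Walk.x y z (flip _ _ zy) (toℕ i)) in
                ⊥-elim (inj i<j (s≤s⁻¹ (toℕ<n j)) e)
          ... | inj₂ (j , 2≤j , j<n , inj , e) = subst (Reach B z) e (along (suc j) (s≤s z≤n) ≤-refl)
            where
            open Walk y z (flip _ _ zy)
            x≢a : ∀ i → x i ≢ a
            x≢a i eq = apart (subst (Reach A y) eq (walk-reach i))
            not-zy : ∀ i → 1 ≤ i → i ≤ j → ¬ Same z y (x i) (x (suc i))
            not-zy i 1≤i i≤j (inj₂ (eq , _)) = inj 1≤i i≤j (sym eq)
            not-zy i 1≤i i≤j (inj₁ (eq , eq′)) with injective≤ inj i≤j (≤-trans (n≤1+n 1) 2≤j) eq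
            ... | refl = inj {0} {2} (s≤s z≤n) 2≤j (sym eq′)
            -- The walk begins with `y`, `z`, so from position 1 on it runs from `z` around the
            -- cycle to `x (suc j)`, which is `y`, without using `zy` again. The other deleted edge
            -- is avoided because `a` is not on the cycle.
            along : ∀ i → 1 ≤ i → i ≤ suc j → Reach B z (x i)
            along (suc zero) _ _ = reach-refl B z
            along (suc (suc i)) _ (s≤s h) = reach-snoc B (along (suc i) (s≤s z≤n) (m≤n⇒m≤1+n h))
              (case bwd _ _ (walk-edge (suc i)) of λ where
                (inj₁ (e′ , _)) → e′
                (inj₂ (inj₁ (inj₁ (eq , _)))) → ⊥-elim (x≢a (suc i) eq)
                (inj₂ (inj₁ (inj₂ (_ , eq)))) → ⊥-elim (x≢a (suc (suc i)) eq)
                (inj₂ (inj₂ sm)) → ⊥-elim (not-zy (suc i) (s≤s z≤n) h sm))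

        merge-joins : Reach B a y
        merge-joins = reach-trans B (reach-edge B add₁) z⇝y

        -- Neither deleted edge separates anything: `zy` is bypassed by the rest of the cycle, and
        -- `ab` by the detour from `a` to `z`, around the cycle to `y` and on to `b`.
        merge-reach : ∀ {u w} → Reach A u w → Reach B u w
        merge-reach {u} = reach-elim A (Reach B u) (reach-refl B u) λ i j r e → reach-trans B r (edge i j e)
          where
          a⇝b : Reach B a b
          a⇝b = reach-snoc B merge-joins (flipB _ _ add₂)
          edge : ∀ i j → E A i j → Reach B i j
          edge i j e with bwd i j e
          ... | inj₁ (e′ , _) = reach-edge B e′
          ... | inj₂ (inj₁ (inj₁ (refl , refl))) = a⇝b
          ... | inj₂ (inj₁ (inj₂ (refl , refl))) = reach-sym B flipB a⇝b
          ... | inj₂ (inj₂ (inj₁ (refl , refl))) = z⇝y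
          ... | inj₂ (inj₂ (inj₂ (refl , refl))) = reach-sym B flipB z⇝y

        -- Serves to bound the order of the merged component by the sum of the two old orders.
        merge-component : ∀ {u} → Reach B a u → Reach A a u ⊎ Reach A y u
        merge-component = reach-elim B (λ u → Reach A a u ⊎ Reach A y u) (inj₁ (reach-refl A a)) stp
          where
          stp : ∀ i j → Reach A a i ⊎ Reach A y i → E B i j → Reach A a j ⊎ Reach A y j
          stp i j h e with fwd i j e
          ... | inj₁ (e′ , _) = [ (λ r → inj₁ (reach-snoc A r e′)) , (λ r → inj₂ (reach-snoc A r e′)) ]′ h
          ... | inj₂ (inj₁ (inj₁ (refl , refl))) = inj₂ y⇝z
          ... | inj₂ (inj₁ (inj₂ (refl , refl))) = inj₁ (reach-refl A a)
          ... | inj₂ (inj₂ (inj₁ (refl , refl))) = inj₂ (reach-refl A y)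
          ... | inj₂ (inj₂ (inj₂ (refl , refl))) = inj₁ (reach-edge A ab)

    -- Cutting a segment out of a walk and closing it up to a cycle.

    module Bite (x₀ x₁ : Fin n) (start : E A x₀ x₁) (K : ℕ)
      (two : ∀ i → i ≤ K → Two (Walk.x x₀ x₁ start i)) (inj : Walk.Injective≤ x₀ x₁ start K)
      (i j : ℕ) (i<j : 4 + i ≤ j) (j<K : suc j ≤ K) where

      open Walk x₀ x₁ start

      -- It starts at `2 + i` so that the vertex `x (1 + i)` before it still has a predecessor on
      -- the walk and both its neighbours are known. The condition `4 + i ≤ j` gives the segment at
      -- least three vertices, so its ends are not yet adjacent.
      Segment : Fin n → Set
      Segment u = ∃ λ k → 2 + i ≤ k × k ≤ j × u ≡ x k

      private
        index : ∀ {k l} → k ≤ K → l ≤ K → x k ≡ x l → k ≡ l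
        index = injective≤ inj

        j≤K : j ≤ K
        j≤K = ≤-trans (n≤1+n j) j<K

        i≤j : ∀ m → m ≤ 4 → m + i ≤ j
        i≤j m h = ≤-trans (+-monoˡ-≤ i h) i<j

        i≤K : ∀ m → m ≤ 4 → m + i ≤ K
        i≤K m h = ≤-trans (i≤j m h) j≤K

      bite-valid : Valid A (x (1 + i)) (x (2 + i)) (x (1 + j)) (x j)
      bite-valid = record
        { pq = walk-edge (1 + i) ; rs = flip _ _ (walk-edge j)
        ; ¬pr = λ e → case walk-neighbours i (two (1 + i) (i≤K 1 (s≤s z≤n))) e of λ where
            (inj₁ eq) → inj {i} {suc j} (s≤s (i≤j 0 z≤n)) j<K (sym eq)
            (inj₂ eq) → inj {2 + i} {suc j} (s≤s (i≤j 2 (s≤s (s≤s z≤n)))) j<K (sym eq)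
        ; ¬qs = λ e → case walk-neighbours (1 + i) (two (2 + i) (i≤K 2 (s≤s (s≤s z≤n)))) e of λ where
            (inj₁ eq) → inj {1 + i} {j} (i≤j 2 (s≤s (s≤s z≤n))) j≤K (sym eq)
            (inj₂ eq) → inj {3 + i} {j} i<j j≤K (sym eq)
        ; p≢r = inj {1 + i} {suc j} (s≤s (i≤j 1 (s≤s z≤n))) j<K
        ; q≢s = inj {2 + i} {j} (i≤j 3 (s≤s (s≤s (s≤s z≤n)))) j≤K }

      module _ {B : Adj n} (flipB : ∀ i j → E B i j → E B j i)
        (sw : Switched A B (x (1 + i)) (x (2 + i)) (x (1 + j)) (x j)) where

        open Switched sw

        private
          pI qI rI sI : ℕ
          pI = 1 + i
          qI = 2 + i
          rI = 1 + j
          sI = j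

          pK : pI ≤ K
          pK = i≤K 1 (s≤s z≤n)

          segment-step : ∀ u w → Segment u → E A u w → Segment w ⊎ (u ≡ x qI × w ≡ x pI) ⊎ (u ≡ x sI × w ≡ x rI)
          segment-step u w (suc k , s≤s a , b , refl) e with walk-neighbours k (two (suc k) (≤-trans b j≤K)) e
          ... | inj₁ refl = case m≤n⇒m<n∨m≡n a of λ where
                (inj₁ lt) → inj₁ (k , lt , ≤-trans (n≤1+n k) b , refl)
                (inj₂ refl) → inj₂ (inj₁ (refl , refl))
          ... | inj₂ refl = case m≤n⇒m<n∨m≡n b of λ where
                (inj₁ lt) → inj₁ (2 + k , s≤s (m≤n⇒m≤1+n a) , lt , refl)
                (inj₂ refl) → inj₂ (inj₂ (refl , refl))

          q∈ : Segment (x qI)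
          q∈ = qI , ≤-refl , i≤j 2 (s≤s (s≤s z≤n)) , refl

          s∈ : Segment (x sI)
          s∈ = sI , i≤j 2 (s≤s (s≤s z≤n)) , ≤-refl , refl

          p∉ : ¬ Segment (x pI)
          p∉ (k , a , b , e) with index pK (≤-trans b j≤K) e
          ... | refl = <-irrefl refl a

          r∉ : ¬ Segment (x rI)
          r∉ (k , a , b , e) with index j<K (≤-trans b j≤K) e
          ... | refl = <-irrefl refl b

        -- The only edges of `A` that leave the segment are the two deleted ones, and each inserted
        -- edge has both ends inside or both outside.
        bite-closed : ∀ {v} → Segment v → ∀ {u} → Reach B v u → Segment u
        bite-closed {v} sv = reach-elim B Segment sv stp
          where
          stp : ∀ u w → Segment u → E B u w → Segment w
          stp u w su e with fwd u w e
          ... | inj₂ (inj₁ (inj₁ (refl , _))) = ⊥-elim (p∉ su)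
          ... | inj₂ (inj₁ (inj₂ (refl , _))) = ⊥-elim (r∉ su)
          ... | inj₂ (inj₂ (inj₁ (_ , refl))) = s∈
          ... | inj₂ (inj₂ (inj₂ (_ , refl))) = q∈
          ... | inj₁ (e′ , n₁ , n₂) with segment-step u w su e′
          ...   | inj₁ sw′ = sw′
          ...   | inj₂ (inj₁ (refl , refl)) = ⊥-elim (n₁ (inj₂ (refl , refl)))
          ...   | inj₂ (inj₂ (refl , refl)) = ⊥-elim (n₂ (inj₂ (refl , refl)))

        bite-connected : ∀ {u} → Segment u → Reach B (x qI) u
        bite-connected (k , a , b , refl) = along k a b
          where
          along : ∀ k → qI ≤ k → k ≤ j → Reach B (x qI) (x k)
          along k a b with m≤n⇒m<n∨m≡n a
          along .qI a b | inj₂ refl = reach-refl B _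
          along (suc k) a b | inj₁ (s≤s lt) = reach-snoc B (along k lt (≤-trans (n≤1+n k) b))
            (case bwd _ _ (walk-edge k) of λ where
              (inj₁ (e , _)) → e
              (inj₂ (inj₁ (inj₁ (e , _)))) → ⊥-elim (p∉ (k , lt , ≤-trans (n≤1+n k) b , sym e))
              (inj₂ (inj₁ (inj₂ (_ , e)))) → ⊥-elim (p∉ (suc k , a , b , sym e))
              (inj₂ (inj₂ (inj₁ (e , _)))) → ⊥-elim (r∉ (k , lt , ≤-trans (n≤1+n k) b , sym e))
              (inj₂ (inj₂ (inj₂ (_ , e)))) → ⊥-elim (r∉ (suc k , a , b , sym e)))

        -- All four vertices of the switch lie on one walk of `A`, so the inserted edges join
        -- vertices that were connected already: a cut enlarges no component.
        bite-refines : ∀ {u w} → Reach B u w → Reach A u w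
        bite-refines {u} = reach-elim B (Reach A u) (reach-refl A u) λ i j r e → reach-trans A r (edge i j e)
          where
          to : ∀ k → Reach A (x₀) (x k)
          to = walk-reach
          between : ∀ k l → Reach A (x k) (x l)
          between k l = reach-trans A (reach-sym A flip (to k)) (to l)
          edge : ∀ i j → E B i j → Reach A i j
          edge i j e with fwd i j e
          ... | inj₁ (e′ , _) = reach-edge A e′
          ... | inj₂ (inj₁ (inj₁ (refl , refl))) = between pI rI
          ... | inj₂ (inj₁ (inj₂ (refl , refl))) = between rI pI
          ... | inj₂ (inj₂ (inj₁ (refl , refl))) = between qI sI
          ... | inj₂ (inj₂ (inj₂ (refl , refl))) = between sI qI

        -- Contracting the segment to x (1 + i) turns a walk of A into a walk of B.
        bite-reach : ∀ {z} → ¬ Segment z → ∀ {u} → Reach A z u → Reach B z u ⊎ Segment u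
        bite-reach {z} z∉ r = [ inj₁ , inj₂ ∘ proj₁ ]′ (reach-elim A P (inj₁ (reach-refl B z)) stp r)
          where
          P : Fin n → Set
          P u = Reach B z u ⊎ (Segment u × Reach B z (x pI))
          outside : ∀ {u} → Segment u → ¬ Reach B z u
          outside su r = z∉ (bite-closed su (reach-sym B flipB r))
          stp : ∀ u w → P u → E A u w → P w
          stp u w (inj₁ r) e with bwd u w e
          ... | inj₁ (e′ , _) = inj₁ (reach-snoc B r e′)
          ... | inj₂ (inj₁ (inj₁ (refl , refl))) = inj₂ (q∈ , r)
          ... | inj₂ (inj₁ (inj₂ (refl , refl))) = ⊥-elim (outside q∈ r)
          ... | inj₂ (inj₂ (inj₁ (refl , refl))) = inj₂ (s∈ , reach-snoc B r (flipB _ _ add₁))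
          ... | inj₂ (inj₂ (inj₂ (refl , refl))) = ⊥-elim (outside s∈ r)
          stp u w (inj₂ (su , r)) e with segment-step u w su e
          ... | inj₁ sw′ = inj₂ (sw′ , r)
          ... | inj₂ (inj₁ (refl , refl)) = inj₁ r
          ... | inj₂ (inj₂ (refl , refl)) = inj₁ (reach-snoc B r add₁)

  -- Degree sums, and distance from the vertices of degree ≠ 2.

  excess : ℕ → ℕ
  excess x = if x ≡ᵇ 2 then 0 else x

  nontwo : ∀ {n} → Vec ℕ n → Fin n → Bool
  nontwo d z = not (lookup d z ≡ᵇ 2)

  sum-allFin-suc : ∀ {n} (h : Fin (suc n) → ℕ) → sum (map h (allFin (suc n))) ≡ h zero + sum (map (h ∘ suc) (allFin n))
  sum-allFin-suc h = cong (h zero +_) (cong sum (trans (map-tabulate suc h) (sym (map-tabulate id (h ∘ suc)))))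

  M≡sum : ∀ {n} (d : Vec ℕ n) → M d ≡ sum (map (excess ∘ lookup d) (allFin n))
  M≡sum Vec.[] = refl
  M≡sum (x Vec.∷ d) = trans (cong (excess x +_) (M≡sum d)) (sym (sum-allFin-suc (excess ∘ lookup (x Vec.∷ d))))

  nontwo-excess : ∀ x → bit (not (x ≡ᵇ 2)) * x ≡ excess x
  nontwo-excess x with x ≡ᵇ 2
  ... | true = refl
  ... | false = +-identityʳ x

  module Degrees {n : ℕ} {d : Vec ℕ n} {A : Adj n} (g : IsGraph d A) (positive : Positive d) where

    open IsGraph g
    open Walks g

    dartsFrom : (Fin n → Bool) → Fin n × Fin n → Bool
    dartsFrom S z = S (proj₁ z) ∧ adj A (proj₁ z) (proj₂ z)

    count-dartsFrom : ∀ S → count (dartsFrom S) (pairs n) ≡ sum (map (λ i → bit (S i) * lookup d i) (allFin n))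
    count-dartsFrom S = trans (count-×-∧ S (adj A) (allFin n) (allFin n)) (sum-cong _ _ (allFin n) (λ i → cong (bit (S i) *_) (deg i)))

    -- Every vertex of `S` is granted two darts; a vertex of degree ≠ 2 charges its whole degree to
    -- `M d`.
    dartsFrom-≤ : ∀ S → count (dartsFrom S) (pairs n) ≤ size S * 2 + M d
    dartsFrom-≤ S = begin
      count (dartsFrom S) (pairs n) ≡⟨ count-dartsFrom S ⟩
      sum (map (λ i → bit (S i) * lookup d i) (allFin n)) ≤⟨ sum-mono _ _ (allFin n) (λ i → pointwise (S i) (lookup d i)) ⟩
      sum (map (λ i → bit (S i) * 2 + excess (lookup d i)) (allFin n)) ≡⟨ sum-+ (λ i → bit (S i) * 2) (excess ∘ lookup d) (allFin n) ⟩
      sum (map (λ i → bit (S i) * 2) (allFin n)) + sum (map (excess ∘ lookup d) (allFin n)) ≡⟨ cong₂ _+_ (sum-*k S 2 (allFin n)) (sym (M≡sum d)) ⟩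
      size S * 2 + M d ∎
      where
      open ≤-Reasoning
      pointwise : ∀ b x → bit b * x ≤ bit b * 2 + excess x
      pointwise false x = z≤n
      pointwise true x with x ≡ᵇ 2 in eq
      ... | true rewrite ≡ᵇ⇒≡ x 2 (subst T (sym eq) tt) = ≤-refl
      ... | false = ≤-trans (≤-reflexive (+-identityʳ x)) (m≤n+m x 2)

    neighbour : ∀ i → ∃ λ j → E A i j
    neighbour i = size-witness (adj A i) (≤-trans (positive i) (≤-reflexive (sym (deg i))))

    nontwo⇒¬Two : ∀ {z} → T (nontwo d z) → ¬ Two z
    nontwo⇒¬Two {z} h e = not-T h (≡⇒≡ᵇ (lookup d z) 2 e)

    ¬nontwo⇒Two : ∀ {z} → ¬ T (nontwo d z) → Two z
    ¬nontwo⇒Two {z} h with lookup d z ≡ᵇ 2 in eq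
    ... | true = ≡ᵇ⇒≡ (lookup d z) 2 (subst T (sym eq) tt)
    ... | false = ⊥-elim (h tt)

    -- waves k are the darts after k steps of all walks leaving the vertices of degree ≠ 2;
    -- near k contains every vertex at distance at most k from those vertices.
    waves : ℕ → List (Fin n × Fin n)
    waves zero = filterᵇ (dartsFrom (nontwo d)) (pairs n)
    waves (suc k) = map next (waves k)

    near : ℕ → List (Fin n)
    near zero = filterᵇ (nontwo d) (allFin n)
    near (suc k) = near k ++ map proj₂ (waves k)

    -- A walk is determined by its first dart, and the darts leaving vertices of degree ≠ 2 number
    -- exactly `M d`. Hence a front does not grow with `k`.
    length-waves : ∀ k → length (waves k) ≡ M d
    length-waves zero = trans (count-dartsFrom (nontwo d))
      (trans (sum-cong _ _ (allFin n) (λ i → nontwo-excess (lookup d i))) (sym (M≡sum d)))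
    length-waves (suc k) = trans (length-map next (waves k)) (length-waves k)

    count-nontwo : size (nontwo d) ≤ M d
    count-nontwo = subst₂ _≤_ (sum-bit (nontwo d) (allFin n)) (sym (M≡sum d)) (sum-mono _ _ (allFin n) pointwise)
      where
      pointwise : ∀ i → bit (nontwo d i) ≤ excess (lookup d i)
      pointwise i with lookup d i ≡ᵇ 2
      ... | true = z≤n
      ... | false = positive i

    length-near : ∀ k → length (near k) ≤ M d + k * M d
    length-near zero = ≤-trans count-nontwo (m≤m+n (M d) 0)
    length-near (suc k) = begin
      length (near k ++ map proj₂ (waves k)) ≡⟨ length-++ (near k) ⟩
      length (near k) + length (map proj₂ (waves k)) ≡⟨ cong (length (near k) +_) (trans (length-map proj₂ (waves k)) (length-waves k)) ⟩
      length (near k) + M d ≤⟨ +-monoˡ-≤ (M d) (length-near k) ⟩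
      M d + k * M d + M d ≡⟨ rearrange (M d) (k * M d) ⟩
      M d + (M d + k * M d) ∎
      where
      open ≤-Reasoning
      rearrange : ∀ a c → a + c + a ≡ a + (a + c)
      rearrange = solve-∀

    wave-edge : ∀ k {p c} → (p , c) ∈ waves k → E A p c × p ∈ near k
    wave-edge zero {p} {c} h with ∈-filterᵇ⁻ (dartsFrom (nontwo d)) {xs = pairs n} h
    ... | _ , e = let (a , b) = T-split {nontwo d p} e in b , ∈-filterᵇ⁺ (nontwo d) (∈-allFin p) a
    wave-edge (suc k) h with ∈-map⁻ next h
    ... | (p , c) , m , refl = other-edge (flip _ _ (proj₁ (wave-edge k m))) , ∈-++⁺ʳ (near k) (∈-map⁺ proj₂ m)

    near-suc : ∀ k {c} → c ∈ near k → c ∈ near (suc k)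
    near-suc k = ∈-++⁺ˡ

    near-zero : ∀ k {c} → c ∈ near 0 → c ∈ near k
    near-zero zero h = h
    near-zero (suc k) h = near-suc k (near-zero k h)

    wave∈near : ∀ k {p c} → (p , c) ∈ waves k → c ∈ near (suc k)
    wave∈near k m = ∈-++⁺ʳ (near k) (∈-map⁺ proj₂ m)

    near-step-0 : ∀ {c a} → c ∈ near 0 → E A c a → a ∈ near 1
    near-step-0 {c} {a} h e = wave∈near 0 (∈-filterᵇ⁺ (dartsFrom (nontwo d)) (∈-pairs (c , a))
      (T-pair (proj₂ (∈-filterᵇ⁻ (nontwo d) {xs = allFin n} h)) e))

    -- A vertex of degree 2 met by a wave has just two neighbours, the one the wave came from and
    -- the one it visits next, so following single walks misses nothing. A vertex of degree ≠ 2
    -- sends waves along all its edges at the outset.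
    near-step : ∀ k {c a} → c ∈ near k → E A c a → a ∈ near (suc k)
    near-step zero h e = near-step-0 h e
    near-step (suc k) {c} {a} h e with ∈-++⁻ (near k) h
    ... | inj₁ m = near-suc (suc k) (near-step k m e)
    ... | inj₂ m with ∈-map⁻ proj₂ m
    ...   | (p , _) , w , refl with T? (nontwo d c)
    ...     | yes nt = near-one k (near-step-0 (∈-filterᵇ⁺ (nontwo d) (∈-allFin c) nt) e)
      where
      near-one : ∀ k → a ∈ near 1 → a ∈ near (suc (suc k))
      near-one zero = near-suc 1
      near-one (suc k) = near-suc (suc (suc k)) ∘ near-one k
    ...     | no nt with neighbours-of-two (¬nontwo⇒Two nt) (flip _ _ (proj₁ (wave-edge k w)))
                  (other-edge (flip _ _ (proj₁ (wave-edge k w)))) (other-≢ (¬nontwo⇒Two nt) ∘ sym) e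
    ...       | inj₁ refl = near-suc (suc k) (near-suc k (proj₂ (wave-edge k w)))
    ...       | inj₂ refl = wave∈near (suc k) (∈-map⁺ next w)

    -- A step lowers the distance to the vertices of degree ≠ 2 by at most 1, so after `i` steps the
    -- walk is still outside `near (K ∸ i)`, and in particular outside `near 0`.
    far-walk : ∀ {K x₀ x₁} (start : E A x₀ x₁) → x₀ ∉ near K → ∀ i → i ≤ K → Two (Walk.x x₀ x₁ start i)
    far-walk {K} {x₀} {x₁} start far i i≤K = ¬nontwo⇒Two λ nt →
      avoid i (K ∸ i) (m+[n∸m]≡n i≤K) (near-zero (K ∸ i) (∈-filterᵇ⁺ (nontwo d) (∈-allFin (x i)) nt))
      where
      open Walk x₀ x₁ start
      avoid : ∀ i j → i + j ≡ K → x i ∉ near j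
      avoid zero j refl = far
      avoid (suc i) j eq h = avoid i (suc j) (trans (+-suc i j) eq) (near-step j h (flip _ _ (walk-edge i)))

    far-vertex : ∀ (S : Fin n → Bool) K → M d + K * M d < size S → ∃ λ u → T (S u) × u ∉ near K
    far-vertex S K lt with any? (λ u → T? (S u) ×-dec ¬? (DecMembership._∈?_ _≟F_ u (near K)))
    ... | yes w = w
    ... | no h = ⊥-elim (<-irrefl refl (<-≤-trans lt (≤-trans (count-≤-list S (Uniq.allFin⁺ n) λ x s →
        case DecMembership._∈?_ _≟F_ x (near K) of λ where
          (yes m) → m
          (no m) → ⊥-elim (h (x , s , m))) (length-near K))))

  -- Double counting of switches.

  valid : ∀ {n} → Adj n → Quad n → Bool
  valid A ((p , q) , (r , s)) =
    adj A p q ∧ (adj A r s ∧ (not (adj A p r) ∧ (not (adj A q s) ∧ (not (p ≟ᵇ r) ∧ not (q ≟ᵇ s)))))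

  switchAt : ∀ {n} → Quad n → Adj n → Adj n
  switchAt ((p , q) , (r , s)) = switch p q r s

  -- The quadruple of the reversed switch: on the switched graph its two pairs are the inserted
  -- edges.
  transposed : ∀ {n} → Quad n → Quad n
  transposed ((p , q) , (r , s)) = (p , r) , (q , s)

  valid⇒ : ∀ {n} {A : Adj n} {p q r s} → T (valid A ((p , q) , (r , s))) → Valid A p q r s
  valid⇒ {A = A} {p} {q} {r} {s} h =
    let (a , h₁) = T-split {adj A p q} h
        (b , h₂) = T-split {adj A r s} h₁
        (c , h₃) = T-split {not (adj A p r)} h₂
        (e , h₄) = T-split {not (adj A q s)} h₃
        (f , f′) = T-split {not (p ≟ᵇ r)} h₄
    in record { pq = a ; rs = b ; ¬pr = not-T c ; ¬qs = not-T e ; p≢r = not-T f ∘ ≡⇒≟ᵇ ; q≢s = not-T f′ ∘ ≡⇒≟ᵇ }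

  ⇒valid : ∀ {n} {A : Adj n} {p q r s} → Valid A p q r s → T (valid A ((p , q) , (r , s)))
  ⇒valid v = T-pair pq (T-pair rs (T-pair (T-not ¬pr) (T-pair (T-not ¬qs) (T-pair (T-not (p≢r ∘ ≟ᵇ⇒≡)) (T-not (q≢s ∘ ≟ᵇ⇒≡))))))
    where open Valid v

  moves : ∀ {n} → (Adj n → Bool) → Adj n → Quad n → Bool
  moves Z A q = valid A q ∧ Z (switchAt q A)

  countAdj : ∀ {n} → (Adj n → Bool) → ℕ
  countAdj {n} X = count X (allAdj n)

  -- A move can be recovered from its outcome: the transposed quadruple gives back the quadruple,
  -- and for a fixed quadruple toggling is injective. So the pairs (graph, move) inject into the
  -- pairs (result, reversed move).
  double-count : ∀ {n} (R R′ : Adj n → Quad n → Bool) → (∀ A q → T (R A q) → T (R′ (switchAt q A) (transposed q))) →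
    sum (map (λ A → count (R A) (quads n)) (allAdj n)) ≤ sum (map (λ A → count (R′ A) (quads n)) (allAdj n))
  double-count {n} R R′ h = subst₂ _≤_ (count-cartesianProduct R (allAdj n) (quads n)) (count-cartesianProduct R′ (allAdj n) (quads n))
    (count-injection (λ (A , q) → switchAt q A , transposed q) (uncurry R) (uncurry R′)
      (Uniq.cartesianProduct⁺ (allAdj-unique n) (quads-unique n))
      (λ (A , q) _ → ∈-cartesianProduct⁺ (allAdj-complete A) (∈-quads q))
      (λ (A , q) → h A q) (λ (A , q) (B , q′) _ _ → inj A q B q′))
    where
    inj : ∀ A q B q′ → (switchAt q A , transposed q) ≡ (switchAt q′ B , transposed q′) → (A , q) ≡ (B , q′)
    inj A ((p , q) , (r , s)) B ((p′ , q′) , (r′ , s′)) e with cong proj₂ e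
    ... | refl = cong (_, ((p , q) , (r , s))) (switch-injective p q r s A B (cong proj₁ e))

  module Stepping {n : ℕ} {d : Vec ℕ n} (positive : Positive d) where

    darts-≤ : ∀ {A} → IsGraph d A → count (uncurry (adj A)) (pairs n) ≤ n * 2 + M d
    darts-≤ g = ≤-trans (Degrees.dartsFrom-≤ g positive (λ _ → true))
      (+-monoˡ-≤ (M d) (*-monoˡ-≤ 2 (size≤n {n} (λ _ → true))))

    -- A graph of `Z` is the result of at most one move for each pair of its darts, these being the
    -- two inserted edges with an orientation.
    switch-bound : (X Z : Adj n → Bool) (k : ℕ) → (∀ A → T (X A) → IsGraph d A × k ≤ count (moves Z A) (quads n)) →
      (∀ A → T (Z A) → IsGraph d A) → countAdj X * k ≤ countAdj Z * ((n * 2 + M d) * (n * 2 + M d))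
    switch-bound X Z k hX hZ = begin
      countAdj X * k ≤⟨ sum-const-on X k (λ A → count (R A) (quads n)) (allAdj n) many ⟩
      sum (map (λ A → count (R A) (quads n)) (allAdj n)) ≤⟨ double-count R R′ forth ⟩
      sum (map (λ A → count (R′ A) (quads n)) (allAdj n)) ≤⟨ sum-bound-on Z D² (λ A → count (R′ A) (quads n)) (allAdj n) few none ⟩
      countAdj Z * D² ∎
      where
      open ≤-Reasoning
      D² = (n * 2 + M d) * (n * 2 + M d)
      R R′ : Adj n → Quad n → Bool
      R A q = X A ∧ moves Z A q
      R′ A q = Z A ∧ (uncurry (adj A) (proj₁ q) ∧ uncurry (adj A) (proj₂ q))
      many : ∀ A → T (X A) → k ≤ count (R A) (quads n)
      many A x = ≤-trans (proj₂ (hX A x)) (count-mono (moves Z A) (R A) (quads n) (λ q m → T-pair x m))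
      forth : ∀ A q → T (R A q) → T (R′ (switchAt q A) (transposed q))
      forth A Q@((p , q) , (r , s)) h =
        let (x , m) = T-split {X A} h
            (v , z) = T-split {valid A Q} m
            sw = switch-switched (proj₁ (hX A x)) (valid⇒ {A = A} v)
        in T-pair z (T-pair (Switched.add₁ sw) (Switched.add₂ sw))
      few : ∀ A → T (Z A) → count (R′ A) (quads n) ≤ D²
      few A z = ≤-trans (count-mono (R′ A) (λ q → uncurry (adj A) (proj₁ q) ∧ uncurry (adj A) (proj₂ q)) (quads n)
          (λ q h → proj₂ (T-split {Z A} h)))
        (≤-trans (≤-reflexive (count-× (uncurry (adj A)) (uncurry (adj A)) (pairs n) (pairs n)))
          (*-mono-≤ (darts-≤ (hZ A z)) (darts-≤ (hZ A z))))
      none : ∀ A → ¬ T (Z A) → count (R′ A) (quads n) ≡ 0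
      none A z = n≤0⇒n≡0 (count-≤-list (R′ A) {ys = []} (quads-unique n) (λ q h → ⊥-elim (z (proj₁ (T-split {Z A} h)))))

    -- The 1 in `suc c` accounts for the graphs of `X` that are in `Z` already; only the others have
    -- to move.
    step-bound : (X Z : Adj n → Bool) (k c : ℕ) → 1 ≤ k → (n * 2 + M d) * (n * 2 + M d) ≤ c * k →
      (∀ A → T (X A) → T (Z A) ⊎ (IsGraph d A × k ≤ count (moves Z A) (quads n))) →
      (∀ A → T (Z A) → IsGraph d A) → countAdj X ≤ suc c * countAdj Z
    step-bound X Z k@(suc _) c _ D²≤ h hZ = ≤-trans
      (count-∨ X Z X′ (allAdj n) (λ A x → T-dec (Z A) inj₁ (λ z → inj₂ (T-pair x (T-not z)))))
      (+-monoʳ-≤ (countAdj Z) (*-cancelʳ-≤ (countAdj X′) (c * countAdj Z) k bound))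
      where
      open ≤-Reasoning
      X′ : Adj n → Bool
      X′ A = X A ∧ not (Z A)
      hX′ : ∀ A → T (X′ A) → IsGraph d A × k ≤ count (moves Z A) (quads n)
      hX′ A x with T-split {X A} x
      ... | a , b = [ ⊥-elim ∘ not-T b , id ]′ (h A a)
      bound : countAdj X′ * k ≤ c * countAdj Z * k
      bound = begin
        countAdj X′ * k ≤⟨ switch-bound X′ Z k hX′ hZ ⟩
        countAdj Z * ((n * 2 + M d) * (n * 2 + M d)) ≤⟨ *-monoʳ-≤ (countAdj Z) D²≤ ⟩
        countAdj Z * (c * k) ≡⟨ rearrange (countAdj Z) c k ⟩
        c * countAdj Z * k ∎
        where
        rearrange : ∀ z c k → z * (c * k) ≡ c * z * k
        rearrange = solve-∀

    manyᵇ : ℕ → (Adj n → Bool) → Adj n → Bool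
    manyᵇ k Z A = isGraph d A ∧ (k ≤ᵇ count (moves Z A) (quads n))

  chain-bound : ∀ {n} (U : ℕ → Adj n → Bool) (q : ℕ) → (∀ t → countAdj (U (suc t)) ≤ q * countAdj (U t)) →
    ∀ t → countAdj (U t) ≤ q ^ t * countAdj (U 0)
  chain-bound U q h zero = ≤-reflexive (sym (+-identityʳ _))
  chain-bound U q h (suc t) = ≤-trans (h t) (≤-trans (*-monoʳ-≤ q (chain-bound U q h t)) (≤-reflexive (sym (*-assoc q (q ^ t) _))))

  size-injection : ∀ {m n} (f : Fin m → Fin n) (p : Fin n → Bool) → (∀ i → T (p (f i))) → (∀ i j → f i ≡ f j → i ≡ j) → m ≤ size p
  size-injection {m} f p h inj = ≤-trans (≤-reflexive (sym (trans (count-true (allFin m)) (length-tabulate id))))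
    (count-injection f (λ _ → true) p (Uniq.allFin⁺ m) (λ y _ → ∈-allFin y) (λ i _ → h i) (λ i j _ _ → inj i j))

  -- Many cuts along one walk.

  module Bites {n : ℕ} {d : Vec ℕ n} {A : Adj n} (g : IsGraph d A) (m : ℕ) (1≤m : 1 ≤ m) where

    open Walks g

    -- Three blocks of `m` positions after an offset of 2: segments start in the first block and end
    -- in the third, which leaves `m * m` choices, and they always contain the `m` vertices of the
    -- middle block.
    walkLength : ℕ
    walkLength = 2 + (m + m + m)

    module _ {x₀ x₁ : Fin n} (start : E A x₀ x₁)
      (two : ∀ i → i ≤ walkLength → Two (Walk.x x₀ x₁ start i))
      (inj : Walk.Injective≤ x₀ x₁ start walkLength) where

      open Walk x₀ x₁ start

      far : Fin m → ℕ
      far j = 2 + (m + m + toℕ j)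

      far-bound : ∀ j → suc (far j) ≤ walkLength
      far-bound j = s≤s (s≤s (≤-trans (≤-reflexive (sym (+-suc (m + m) (toℕ j)))) (+-monoʳ-≤ (m + m) (toℕ<n j))))

      far-beyond : ∀ i j → 4 + toℕ i ≤ far j
      far-beyond i j = s≤s (s≤s (≤-trans (s≤s (toℕ<n i)) (≤-trans (+-monoˡ-≤ m 1≤m) (m≤m+n (m + m) (toℕ j)))))

      module B (i j : Fin m) = Bite x₀ x₁ start walkLength two inj (toℕ i) (far j) (far-beyond i j) (far-bound j)

      biteQuad : Fin m → Fin m → Quad n
      biteQuad i j = (x (1 + toℕ i) , x (2 + toℕ i)) , (x (1 + far j) , x (far j))

      bites-many : (Z : Adj n → Bool) →
        (∀ i j {C} → IsGraph d C → Switched A C (x (1 + toℕ i)) (x (2 + toℕ i)) (x (1 + far j)) (x (far j)) → T (Z C)) →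
        m * m ≤ count (moves Z A) (quads n)
      bites-many Z h = subst (_≤ count (moves Z A) (quads n))
        (trans (count-× (λ _ → true) (λ _ → true) (allFin m) (allFin m)) (cong₂ _*_ all all))
        (count-injection (uncurry biteQuad) (λ _ → true) (moves Z A) (Uniq.cartesianProduct⁺ (Uniq.allFin⁺ m) (Uniq.allFin⁺ m))
          (λ q _ → ∈-quads q) (λ (i , j) _ → T-pair (⇒valid (B.bite-valid i j)) (h i j (switch-isGraph g (B.bite-valid i j)) (switch-switched g (B.bite-valid i j)))) (λ (i , j) (i′ , j′) _ _ → quad-inj i j i′ j′))
        where
        all : count (λ _ → true) (allFin m) ≡ m
        all = trans (count-true (allFin m)) (length-tabulate id)
        near≤ : ∀ i → 1 + toℕ i ≤ walkLength
        near≤ i = ≤-trans (m≤n+m (1 + toℕ i) 3) (≤-trans (far-beyond i i) (≤-trans (n≤1+n _) (far-bound i)))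
        quad-inj : ∀ i j i′ j′ → biteQuad i j ≡ biteQuad i′ j′ → (i , j) ≡ (i′ , j′)
        quad-inj i j i′ j′ e = cong₂ _,_
          (toℕ-injective (suc-injective (injective≤ inj (near≤ i) (near≤ i′) (cong (proj₁ ∘ proj₁) e))))
          (toℕ-injective (+-cancelˡ-≡ (m + m) _ _ (suc-injective (suc-injective
            (injective≤ inj (≤-trans (n≤1+n _) (far-bound j)) (≤-trans (n≤1+n _) (far-bound j′)) (cong (proj₂ ∘ proj₂) e))))))

      segment-large : ∀ i j (S : Fin n → Bool) → (∀ u → B.Segment i j u → T (S u)) → m ≤ size S
      segment-large i j S h = size-injection (λ t → x (2 + toℕ i + toℕ t)) S
        (λ t → h _ (2 + toℕ i + toℕ t , m≤m+n _ _ , bound t , refl))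
        (λ t t′ e → toℕ-injective (+-cancelˡ-≡ (2 + toℕ i) _ _ (injective≤ inj (bound′ t) (bound′ t′) e)))
        where
        bound : ∀ t → 2 + toℕ i + toℕ t ≤ far j
        bound t = s≤s (s≤s (≤-trans (+-mono-≤ (<⇒≤ (toℕ<n i)) (<⇒≤ (toℕ<n t))) (m≤m+n (m + m) (toℕ j))))
        bound′ : ∀ t → 2 + toℕ i + toℕ t ≤ walkLength
        bound′ t = ≤-trans (bound t) (≤-trans (n≤1+n _) (far-bound j))

      segment-small : ∀ i j (S : Fin n → Bool) → (∀ u → T (S u) → B.Segment i j u) → size S ≤ walkLength
      segment-small i j S h = ≤-trans (count-≤-list S (Uniq.allFin⁺ n) inList) (≤-reflexive (length-applyUpTo x walkLength))
        where
        inList : ∀ u → T (S u) → u ∈ applyUpTo x walkLength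
        inList u s with h u s
        ... | k , _ , k≤ , refl = ∈-applyUpTo⁺ x (≤-trans (s≤s k≤) (far-bound j))

  -- Components of order at least γ n, where γ is `a / D`.

  module Big (a D : ℕ) where

    bigAt : ∀ {n} → Adj n → Fin n → Bool
    bigAt {n} A v = a * n ≤ᵇ size (component A v) * D

    hasBig : ∀ {n} → Adj n → Bool
    hasBig A = anyFin (bigAt A)

    small-components : 8 * a ≤ D → ∀ {n} {A : Adj n} → ¬ T (hasBig A) → ∀ v → 8 * size (component A v) < n
    small-components 8a≤D {n} {A} ¬big v = ≰⇒> λ le → ¬big (anyFin⁺ (bigAt A) v (≤⇒≤ᵇ {a * n} (begin
      a * n ≤⟨ *-monoʳ-≤ a le ⟩
      a * (8 * size (component A v)) ≡⟨ rearrange a (size (component A v)) ⟩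
      size (component A v) * (8 * a) ≤⟨ *-monoʳ-≤ (size (component A v)) 8a≤D ⟩
      size (component A v) * D ∎)))
      where
      open ≤-Reasoning
      rearrange : ∀ a s → a * (8 * s) ≡ s * (8 * a)
      rearrange = solve-∀

    -- Destroying all large components.

    module Splitting {n : ℕ} {d : Vec ℕ n} (positive : Positive d) (m : ℕ) (1≤m : 1 ≤ m)
      (small-near : (M d + (2 + (m + m + m)) * M d) * D < a * n) (small-segment : (2 + (m + m + m)) * D < a * n) where

      private
        K : ℕ
        K = 2 + (m + m + m)

      bigVertices : Adj n → ℕ
      bigVertices A = size (bigAt A)

      -- The potential is the number of vertices in big components, measured in units of `m`, the
      -- guaranteed loss per cut.
      Level : ℕ → Adj n → Bool
      Level t A = isGraph d A ∧ (bigVertices A ≤ᵇ t * m)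

      module _ (t : ℕ) {A : Adj n} (g : IsGraph d A) (Φ≤ : bigVertices A ≤ suc t * m) {v : Fin n} (v-size : a * n ≤ size (component A v) * D) where

        open IsGraph g
        open Walks g
        open Bites g m 1≤m

        split-along : ∀ {u c} (u∼c : E A u c) → Reach A v u → (∀ i → i ≤ K → Two (Walk.x u c u∼c i)) →
          Walk.Injective≤ u c u∼c K → m * m ≤ count (moves (Level t) A) (quads n)
        split-along {u} {c} u∼c v⇝u two inj = bites-many u∼c two inj (Level t) level
          where
          open Walk u c u∼c
          level : ∀ i j {C} → IsGraph d C → Switched A C (x (1 + toℕ i)) (x (2 + toℕ i)) (x (1 + far u∼c two inj j)) (x (far u∼c two inj j)) → T (Level t C)
          -- The new cycle has at least `m` vertices, all of them big in `A`, and is too short to be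
          -- big in `C`. No vertex becomes big, since components only shrink.
          level i j {C} gC sw = T-pair {isGraph d C} (⇒isGraph d C gC) (≤⇒≤ᵇ (+-cancelˡ-≤ m _ _ (begin
              m + bigVertices C ≤⟨ +-monoˡ-≤ (bigVertices C) (segment-large u∼c two inj i j (component C q) (λ w → bite-connected flipC sw)) ⟩
              size (component C q) + bigVertices C ≤⟨ count-disjoint (component C q) (bigAt C) (bigAt A) (allFin n) cut kept apart ⟩
              bigVertices A ≤⟨ Φ≤ ⟩
              m + t * m ∎)))
            where
            open ≤-Reasoning
            open B u∼c two inj i j
            flipC = IsGraph.flip gC
            q : Fin n
            q = x (2 + toℕ i)
            q∈ : Segment q
            q∈ = 2 + toℕ i , ≤-refl , ≤-trans (m≤n+m _ 2) (far-beyond u∼c two inj i j) , refl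
            cut : ∀ w → Reach C q w → T (bigAt A w)
            cut w r with bite-closed flipC sw q∈ r
            ... | k , _ , _ , refl = ≤⇒≤ᵇ {a * n} (≤-trans v-size (*-monoˡ-≤ D
                    (count-mono (component A v) (component A (x k)) (allFin n)
                      (λ y → reach-trans A (reach-sym A flip (reach-trans A v⇝u (walk-reach k)))))))
            kept : ∀ w → T (bigAt C w) → T (bigAt A w)
            kept w b = ≤⇒≤ᵇ {a * n} (≤-trans (≤ᵇ⇒≤ (a * n) _ b) (*-monoˡ-≤ D
              (count-mono (component C w) (component A w) (allFin n) (λ y → bite-refines flipC sw))))
            apart : ∀ w → Reach C q w → T (bigAt C w) → ⊥
            apart w r b = <-irrefl refl (<-≤-trans small-segment (≤-trans (≤ᵇ⇒≤ (a * n) _ b) (*-monoˡ-≤ D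
              (segment-small u∼c two inj i j (component C w) (λ y → bite-closed flipC sw (bite-closed flipC sw q∈ r))))))

        -- A walk that closes up would fit the whole component of `v` into `K` vertices, too few for
        -- a big one.
        not-closed : ∀ {u c} (u∼c : E A u c) → Reach A v u → (∀ i → i ≤ K → Two (Walk.x u c u∼c i)) → ¬ Walk.Closes u c u∼c K
        not-closed {u} {c} u∼c v⇝u two cl@(j , _ , j<K , _) = <-irrefl refl (<-≤-trans small-segment (≤-trans v-size (*-monoˡ-≤ D
            (≤-trans (count-≤-list (component A v) (Uniq.allFin⁺ n) inList) (≤-reflexive (length-applyUpTo x K))))))
          where
          open Walk u c u∼c
          inList : ∀ w → Reach A v w → w ∈ applyUpTo x K
          inList w r with closed-component two cl (reach-trans A (reach-sym A flip v⇝u) r)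
          ... | i , i≤j , refl = ∈-applyUpTo⁺ x (≤-<-trans i≤j j<K)

        split-many : m * m ≤ count (moves (Level t) A) (quads n)
        split-many with Degrees.far-vertex g positive (component A v) K (*-cancelʳ-< D _ _ (<-≤-trans small-near v-size))
        ... | u , v⇝u , far-u with Degrees.neighbour g positive u
        ...   | c , u∼c = [ split-along u∼c v⇝u two , ⊥-elim ∘ not-closed u∼c v⇝u two ]′ (Walk.injective-or-closes u c u∼c K two)
          where
          two : ∀ i → i ≤ K → Two (Walk.x u c u∼c i)
          two = Degrees.far-walk g positive u∼c far-u

      split-bound : ∀ c T′ → (n * 2 + M d) * (n * 2 + M d) ≤ c * (m * m) → n ≤ T′ * m →
        countAdj (isGraph d) ≤ suc c ^ T′ * countAdj (λ A → isGraph d A ∧ not (hasBig A))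
      split-bound c T′ D²≤ n≤ = begin
        countAdj (isGraph d) ≤⟨ count-mono (isGraph d) (Level T′) (allAdj n) (λ A g → T-pair g (≤⇒≤ᵇ (≤-trans (size≤n (bigAt A)) n≤))) ⟩
        countAdj (Level T′) ≤⟨ chain-bound Level (suc c) one T′ ⟩
        suc c ^ T′ * countAdj (Level 0) ≤⟨ *-monoʳ-≤ (suc c ^ T′) (count-mono (Level 0) _ (allAdj n) none) ⟩
        suc c ^ T′ * countAdj (λ A → isGraph d A ∧ not (hasBig A)) ∎
        where
        open ≤-Reasoning
        one : ∀ t → countAdj (Level (suc t)) ≤ suc c * countAdj (Level t)
        one t = Stepping.step-bound positive (Level (suc t)) (Level t) (m * m) c (*-mono-≤ 1≤m 1≤m) D²≤
          (λ A h → let (gr , le) = T-split {isGraph d A} h in case bigVertices A ≤? t * m of λ where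
            (yes p) → inj₁ (T-pair gr (≤⇒≤ᵇ p))
            (no ¬p) → inj₂ (isGraph⇒ d A gr , split-many t (isGraph⇒ d A gr) (≤ᵇ⇒≤ _ _ le)
               (≤ᵇ⇒≤ _ _ (proj₂ (size-witness (bigAt A) (≤-trans (s≤s z≤n) (≰⇒> ¬p)))))))
          (λ A h → isGraph⇒ d A (proj₁ (T-split {isGraph d A} h)))
        none : ∀ A → T (Level 0 A) → T (isGraph d A ∧ not (hasBig A))
        none A h = let (gr , le) = T-split {isGraph d A} h in T-pair gr (T-not λ b →
          let (v , bv) = anyFin⁻ (bigAt A) b in
          case ≤-trans (count-≥1 v bv) (≤ᵇ⇒≤ _ _ le) of λ ())
          where
          count-≥1 : ∀ v → T (bigAt A v) → 1 ≤ bigVertices A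
          count-≥1 v bv = size-injection {1} (λ _ → v) (bigAt A) (λ _ → bv) (λ { zero zero _ → refl })

  -- Counting merges.

  module Merges {n : ℕ} {d : Vec ℕ n} (positive : Positive d) {B : Adj n} (g : IsGraph d B) (S₁ S₂ : Fin n → Bool)
    (cyclic : ∀ y → T (S₂ y) → ∀ u → Reach B y u → lookup d u ≡ 2)
    (apart : ∀ a y → T (S₁ a) → T (S₂ y) → ¬ Reach B y a) where

    open IsGraph g
    open Walks g
    open Degrees g positive

    -- One chosen neighbour for each of `a` and `y` gives a merge for every pair, and the pair can
    -- be read off from the outer entries of the quadruple.
    merges-many : (Z : Adj n → Bool) →
      (∀ {a b y w C} → T (S₁ a) → T (S₂ y) → E B a b → E B w y → IsGraph d C → Switched B C a b w y → T (Z C)) →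
      size S₁ * size S₂ ≤ count (moves Z B) (quads n)
    merges-many Z h = subst (_≤ count (moves Z B) (quads n)) (count-× S₁ S₂ (allFin n) (allFin n))
      (count-injection quad (λ p → S₁ (proj₁ p) ∧ S₂ (proj₂ p)) (moves Z B) (pairs-unique n) (λ q _ → ∈-quads q)
        (λ (a , y) s → let (s₁ , s₂) = T-split {S₁ a} s in good a y s₁ s₂)
        (λ p p′ _ _ e → cong₂ _,_ (cong (proj₁ ∘ proj₁) e) (cong (proj₂ ∘ proj₂) e)))
      where
      quad : Fin n × Fin n → Quad n
      quad (a , y) = (a , proj₁ (neighbour a)) , (proj₁ (neighbour y) , y)
      good : ∀ a y → T (S₁ a) → T (S₂ y) → T (moves Z B (quad (a , y)))
      good a y s₁ s₂ = T-pair (⇒valid v) (h s₁ s₂ ab wy (switch-isGraph g v) (switch-switched g v))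
        where
        ab = proj₂ (neighbour a)
        wy = flip _ _ (proj₂ (neighbour y))
        v = Merge.merge-valid ab wy (cyclic y s₂) (apart a y s₁ s₂)

  -- The components outside the core have only vertices of degree 2: they are the cycles that a
  -- merge can absorb.
  core : ∀ {n} → Vec ℕ n → Adj n → Fin n → Bool
  core d A u = anyFin (λ z → nontwo d z ∧ component A z u)

  core⁺ : ∀ {n} (d : Vec ℕ n) (A : Adj n) z {u} → T (nontwo d z) → Reach A z u → T (core d A u)
  core⁺ d A z {u} nt r = anyFin⁺ (λ z → nontwo d z ∧ component A z u) z (T-pair nt r)

  core⁻ : ∀ {n} (d : Vec ℕ n) (A : Adj n) u → T (core d A u) → ∃ λ z → T (nontwo d z) × Reach A z u
  core⁻ d A u h with anyFin⁻ (λ z → nontwo d z ∧ component A z u) h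
  ... | z , e = z , T-split {nontwo d z} e

  -- Growing one component of the core.

  module Growing (a D : ℕ) (8a≤D : 8 * a ≤ D) {n : ℕ} {d : Vec ℕ n} (positive : Positive d) (m : ℕ) (1≤m : 1 ≤ m)
    (small-near : 8 * (M d + (2 + (m + m + m)) * M d) < 2 * n) where

    open Big a D
    open Stepping {d = d} positive

    private
      K : ℕ
      K = 2 + (m + m + m)

    -- Since `z` has degree ≠ 2, whatever is merged into its component joins the core, so the core
    -- keeps its size while the component grows.
    hub : ℕ → Adj n → Fin n → Bool
    hub t A z = nontwo d z ∧ (suc t * m ≤ᵇ size (component A z))

    rich : ℕ → Adj n → Bool
    rich t A = (3 * n ≤ᵇ 8 * size (core d A)) ∧ anyFin (hub t A)

    Level : ℕ → Adj n → Bool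
    Level t A = isGraph d A ∧ (hasBig A ∨ rich t A)

    -- Meant for the graphs between cut and merge. There the cut-off cycle is missing from the core,
    -- whose lower bound may fail, so only the supply of moves to the next level is recorded.
    Half : ℕ → Adj n → Bool
    Half t A = Level (suc t) A ∨ manyᵇ (m * m) (Level (suc t)) A

    -- In the application `core₀` is the core before the cut. The cut loses from it only vertices of
    -- the cycle through `q`, and every merge counted here puts that cycle back.
    merge-level : ∀ t {B : Adj n} → IsGraph d B → (core₀ : Fin n → Bool) → 3 * n ≤ 8 * size core₀ →
      ∀ z q → T (nontwo d z) → suc t * m ≤ size (component B z) → m ≤ size (component B q) →
      (∀ u → Reach B q u → lookup d u ≡ 2) → ¬ Reach B q z →
      (∀ u → T (core₀ u) → T (core d B u) ⊎ Reach B q u) →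
      m * m ≤ count (moves (Level (suc t)) B) (quads n)
    merge-level t {B} g core₀ large z q nt z-size q-size cyclic apart covered = ≤-trans
      (*-mono-≤ (≤-trans (m≤m+n m (t * m)) z-size) q-size)
      (Merges.merges-many positive g (component B z) (component B q) cyclic′ apart′ (Level (suc t)) level)
      where
      open IsGraph g
      open Walks g
      reach-flip : ∀ {i j} → Reach B i j → Reach B j i
      reach-flip = reach-sym B flip
      cyclic′ : ∀ y → Reach B q y → ∀ u → Reach B y u → lookup d u ≡ 2
      cyclic′ y r u r′ = cyclic u (reach-trans B r r′)
      apart′ : ∀ v y → Reach B z v → Reach B q y → ¬ Reach B y v
      apart′ v y zv qy yv = apart (reach-trans B qy (reach-trans B yv (reach-flip zv)))
      level : ∀ {v b y w C} → Reach B z v → Reach B q y → E B v b → E B w y → IsGraph d C → Switched B C v b w y → T (Level (suc t) C)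
      level {v} {b} {y} {w} {C} zv qy vb wy gC sw = T-pair {isGraph d C} (⇒isGraph d C gC) (T-inr {hasBig C} (T-pair
          (≤⇒≤ᵇ {3 * n} (≤-trans large (*-monoʳ-≤ 8 (count-mono core₀ (core d C) (allFin n) core-kept))))
          (anyFin⁺ (hub (suc t) C) z (T-pair nt (≤⇒≤ᵇ {suc (suc t) * m} (begin
            m + suc t * m ≤⟨ +-mono-≤ q-size z-size ⟩
            size (component B q) + size (component B z) ≤⟨ count-disjoint (component B q) (component B z) (component C z) (allFin n)
                (λ u → from-q) (λ u → lift) (λ u qu zu → apart (reach-trans B qu (reach-flip zu))) ⟩
            size (component C z) ∎))))))
        where
        open ≤-Reasoning
        open Merge vb wy (cyclic′ y qy) (apart′ v y zv qy)
        flipC = IsGraph.flip gC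
        lift : ∀ {i j} → Reach B i j → Reach C i j
        lift = merge-reach flipC sw
        from-q : ∀ {u} → Reach B q u → Reach C z u
        from-q qu = reach-trans C (lift zv) (reach-trans C (merge-joins flipC sw) (lift (reach-trans B (reach-flip qy) qu)))
        core-kept : ∀ u → T (core₀ u) → T (core d C u)
        core-kept u c with covered u c
        ... | inj₂ qu = core⁺ d C z nt (from-q qu)
        ... | inj₁ cb with core⁻ d B u cb
        ...   | z′ , nt′ , r = core⁺ d C z′ nt′ (lift r)

    module _ (t : ℕ) {A : Adj n} (g : IsGraph d A) (large : 3 * n ≤ 8 * size (core d A)) {z : Fin n} (nt : T (nontwo d z))
      (z-size : suc t * m ≤ size (component A z)) where

      open IsGraph g
      open Walks g
      open Degrees g positive
      open Bites g m 1≤m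

      -- The cut is made in a component that avoids `z`, so the component of `z` stays whole, and
      -- the detached cycle supplies the `m` vertices by which the hub is to grow.
      grow-along : ∀ {u c} (u∼c : E A u c) → ¬ Reach A u z → (∀ i → i ≤ K → Two (Walk.x u c u∼c i)) →
        Walk.Injective≤ u c u∼c K → m * m ≤ count (moves (Half t) A) (quads n)
      grow-along {u} {c} u∼c apart two inj = bites-many u∼c two inj (Half t) half
        where
        open Walk u c u∼c
        half : ∀ i j {C} → IsGraph d C → Switched A C (x (1 + toℕ i)) (x (2 + toℕ i)) (x (1 + far u∼c two inj j)) (x (far u∼c two inj j)) → T (Half t C)
        half i j {C} gC sw = T-inr {Level (suc t) C} (T-pair (⇒isGraph d C gC) (≤⇒≤ᵇ {m * m}
            (merge-level t gC (core d A) large z q nt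
              (≤-trans z-size (count-mono (component A z) (component C z) (allFin n) z-kept))
              (segment-large u∼c two inj i j (component C q) (λ w → bite-connected flipC sw))
              (λ w r → segment-two w (bite-closed flipC sw q∈ r))
              (λ r → z∉ (bite-closed flipC sw q∈ r))
              covered)))
          where
          open B u∼c two inj i j
          flipC = IsGraph.flip gC
          q : Fin n
          q = x (2 + toℕ i)
          q∈ : Segment q
          q∈ = 2 + toℕ i , ≤-refl , ≤-trans (m≤n+m _ 2) (far-beyond u∼c two inj i j) , refl
          segment-two : ∀ w → Segment w → Two w
          segment-two w (k , _ , k≤ , refl) = two k (≤-trans k≤ (≤-trans (n≤1+n _) (far-bound u∼c two inj j)))
          u⇝ : ∀ {w} → Segment w → Reach A u w
          u⇝ (k , _ , _ , refl) = walk-reach k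
          z∉ : ¬ Segment z
          z∉ s = apart (u⇝ s)
          z-kept : ∀ w → Reach A z w → Reach C z w
          z-kept w r = [ id , (λ s → ⊥-elim (apart (reach-trans A (u⇝ s) (reach-sym A flip r)))) ]′ (bite-reach flipC sw z∉ r)
          covered : ∀ w → T (core d A w) → T (core d C w) ⊎ Reach C q w
          covered w h with core⁻ d A w h
          ... | z′ , nt′ , r = [ inj₁ ∘ core⁺ d C z′ nt′ , inj₂ ∘ bite-connected flipC sw ]′
                (bite-reach flipC sw (λ s → nontwo⇒¬Two nt′ (segment-two z′ s)) r)

      -- A walk that closes up is an entire component with all degrees 2, hence disjoint from the
      -- core.
      core-not-closed : ∀ {u c} (u∼c : E A u c) → T (core d A u) → (∀ i → i ≤ K → Two (Walk.x u c u∼c i)) → ¬ Walk.Closes u c u∼c K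
      core-not-closed {u} {c} u∼c cu two cl@(j , _ , j<K , _) with core⁻ d A u cu
      ... | z′ , nt′ , r with Walk.closed-component u c u∼c two cl (reach-sym A flip r)
      ...   | i , i≤j , refl = nontwo⇒¬Two nt′ (two i (≤-trans i≤j (<⇒≤ j<K)))

      grow-many : 8 * size (component A z) < n → m * m ≤ count (moves (Half t) A) (quads n)
      grow-many small with far-vertex (λ u → core d A u ∧ not (component A z u)) K (*-cancelˡ-< 8 _ _ (<-≤-trans small-near outside-large))
        where
        open ≤-Reasoning
        S : Fin n → Bool
        S u = core d A u ∧ not (component A z u)
        -- The core has at least 3 n/8 vertices, and the component of `z` fewer than n/8.
        outside-large : 2 * n ≤ 8 * size S
        outside-large = +-cancelʳ-≤ n _ _ (begin
          2 * n + n ≡⟨ rearrange n ⟩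
          3 * n ≤⟨ large ⟩
          8 * size (core d A) ≤⟨ *-monoʳ-≤ 8 (count-∨ (core d A) S (component A z) (allFin n)
             (λ u c → T-dec (component A z u) inj₂ (λ o → inj₁ (T-pair c (T-not o))))) ⟩
          8 * (size S + size (component A z)) ≡⟨ *-distribˡ-+ 8 (size S) _ ⟩
          8 * size S + 8 * size (component A z) ≤⟨ +-monoʳ-≤ (8 * size S) (<⇒≤ small) ⟩
          8 * size S + n ∎)
          where
          rearrange : ∀ n → 2 * n + n ≡ 3 * n
          rearrange = solve-∀
      ... | u , su , far-u with T-split {core d A u} su | neighbour u
      ...   | cu , ¬zu | c , u∼c = [ grow-along u∼c (λ r → not-T ¬zu (reach-sym A flip r)) two , ⊥-elim ∘ core-not-closed u∼c cu two ]′
                (Walk.injective-or-closes u c u∼c K two)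
        where
        two : ∀ i → i ≤ K → Two (Walk.x u c u∼c i)
        two = far-walk u∼c far-u

    level-graph : ∀ t A → T (Level t A) → IsGraph d A
    level-graph t A h = isGraph⇒ d A (proj₁ (T-split {isGraph d A} h))

    half-graph : ∀ t A → T (Half t A) → IsGraph d A
    half-graph t A h = [ level-graph (suc t) A , (λ x → isGraph⇒ d A (proj₁ (T-split {isGraph d A} x))) ]′ (T-cases {Level (suc t) A} h)

    grow-bound : ∀ c T′ → (n * 2 + M d) * (n * 2 + M d) ≤ c * (m * m) → n ≤ T′ * m →
      countAdj (Level 0) ≤ (suc c * suc c) ^ T′ * countAdj (λ A → isGraph d A ∧ hasBig A)
    grow-bound c T′ D²≤ n≤ = ≤-trans (chain T′) (*-monoʳ-≤ ((suc c * suc c) ^ T′) (count-mono (Level T′) (λ A → isGraph d A ∧ hasBig A) (allAdj n) last))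
      where
      1≤mm : 1 ≤ m * m
      1≤mm = *-mono-≤ 1≤m 1≤m
      first-half : ∀ t → countAdj (Level t) ≤ suc c * countAdj (Half t)
      first-half t = step-bound (Level t) (Half t) (m * m) c 1≤mm D²≤ move (half-graph t)
        where
        move : ∀ A → T (Level t A) → T (Half t A) ⊎ (IsGraph d A × m * m ≤ count (moves (Half t) A) (quads n))
        move A h = let (gr , hr) = T-split {isGraph d A} h in T-dec (hasBig A)
          (λ b → inj₁ (T-inl (T-pair gr (T-inl b))))
          (λ ¬b → inj₂ (isGraph⇒ d A gr , (case T-cases {hasBig A} hr of λ where
            (inj₁ b) → ⊥-elim (¬b b)
            (inj₂ r) → let (large , hb) = T-split {3 * n ≤ᵇ 8 * size (core d A)} r
                           (z , hz) = anyFin⁻ (hub t A) hb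
                           (nt , zs) = T-split {nontwo d z} hz
                       in grow-many t (isGraph⇒ d A gr) (≤ᵇ⇒≤ (3 * n) _ large) nt (≤ᵇ⇒≤ (suc t * m) _ zs) (small-components 8a≤D ¬b z))))
      second-half : ∀ t → countAdj (Half t) ≤ suc c * countAdj (Level (suc t))
      second-half t = step-bound (Half t) (Level (suc t)) (m * m) c 1≤mm D²≤
        (λ A h → case T-cases {Level (suc t) A} h of λ where
          (inj₁ l) → inj₁ l
          (inj₂ x) → let (gr , k) = T-split {isGraph d A} x in inj₂ (isGraph⇒ d A gr , ≤ᵇ⇒≤ (m * m) _ k))
        (level-graph (suc t))
      chain : ∀ t → countAdj (Level 0) ≤ (suc c * suc c) ^ t * countAdj (Level t)
      chain zero = ≤-reflexive (sym (+-identityʳ _))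
      chain (suc t) = begin
        countAdj (Level 0) ≤⟨ chain t ⟩
        Q ^ t * countAdj (Level t) ≤⟨ *-monoʳ-≤ (Q ^ t) (≤-trans (first-half t) (*-monoʳ-≤ (suc c) (second-half t))) ⟩
        Q ^ t * (suc c * (suc c * countAdj (Level (suc t)))) ≡⟨ rearrange (Q ^ t) (suc c) _ ⟩
        Q ^ suc t * countAdj (Level (suc t)) ∎
        where
        open ≤-Reasoning
        Q = suc c * suc c
        rearrange : ∀ p q r → p * (q * (q * r)) ≡ q * q * p * r
        rearrange = solve-∀
      -- On level `T′` the component of a hub would have at least `n` vertices, against fewer than
      -- n/8 if no component is big.
      last : ∀ A → T (Level T′ A) → T (isGraph d A ∧ hasBig A)
      last A h = let (gr , hr) = T-split {isGraph d A} h in T-pair gr (T-dec (hasBig A) id λ ¬b → case T-cases {hasBig A} hr of λ where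
        (inj₁ b) → b
        (inj₂ r) → let (z , hz) = anyFin⁻ (hub T′ A) (proj₂ (T-split {3 * n ≤ᵇ 8 * size (core d A)} r))
                       zs = ≤ᵇ⇒≤ (suc T′ * m) _ (proj₂ (T-split {nontwo d z} hz))
                       le = ≤-trans n≤ (≤-trans (m≤n+m (T′ * m) m) zs)
                   in ⊥-elim (<-irrefl refl (<-≤-trans (small-components 8a≤D ¬b z) (≤-trans le (m≤n*m _ 8)))))

    -- Every core vertex is assigned to one vertex of degree ≠ 2 in its component. The bound serves
    -- as a pigeonhole: a large core forces a large component for some such vertex.
    core-≤ : ∀ {A : Adj n} k → (∀ z → T (nontwo d z) → size (component A z) ≤ k) → size (core d A) ≤ size (nontwo d) * k
    core-≤ {A} k small = begin
      size (core d A) ≤⟨ count-injection (λ u → source u , u) (core d A) (uncurry r) (Uniq.allFin⁺ n) (λ y _ → ∈-pairs y) source-good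
          (λ u w _ _ e → cong proj₂ e) ⟩
      count (uncurry r) (pairs n) ≡⟨ count-×-∧ (nontwo d) (component A) (allFin n) (allFin n) ⟩
      sum (map (λ z → bit (nontwo d z) * size (component A z)) (allFin n)) ≤⟨ sum-mono _ _ (allFin n) pointwise ⟩
      sum (map (λ z → bit (nontwo d z) * k) (allFin n)) ≡⟨ sum-*k (nontwo d) k (allFin n) ⟩
      size (nontwo d) * k ∎
      where
      open ≤-Reasoning
      r : Fin n → Fin n → Bool
      r z u = nontwo d z ∧ component A z u
      source : Fin n → Fin n
      source u with any? (λ z → T? (r z u))
      ... | yes (z , _) = z
      ... | no _ = u
      source-good : ∀ u → T (core d A u) → T (r (source u) u)
      source-good u h with any? (λ z → T? (r z u))
      ... | yes (z , e) = e
      ... | no ¬e = ⊥-elim (¬e (anyFin⁻ (λ z → r z u) h))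
      pointwise : ∀ z → bit (nontwo d z) * size (component A z) ≤ bit (nontwo d z) * k
      pointwise z with nontwo d z | small z
      ... | true | h = +-monoˡ-≤ 0 (h tt)
      ... | false | _ = z≤n

  -- Absorbing cycles into the component of a fixed vertex.

  module Anchoring (a D : ℕ) (8a≤D : 8 * a ≤ D) {n : ℕ} {d : Vec ℕ n} (positive : Positive d) (v : Fin n) (few : 4 * M d ≤ n) where

    open Big a D

    outside : Adj n → Fin n → Bool
    outside A u = not (core d A u) ∧ not (component A v u)

    Loose : Adj n → Bool
    Loose A = isGraph d A ∧ (not (hasBig A) ∧ (n ≤ᵇ 2 * size (outside A)))

    private
      -- All that is retained of a merged graph: two components of order below n/8 give one of order
      -- at most n/4.
      Moderate : Adj n → Bool
      Moderate A = isGraph d A ∧ (4 * size (component A v) ≤ᵇ n)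

      atAnchor : Adj n → Fin n × Fin n → Bool
      atAnchor A z = (proj₁ z ≟ᵇ v) ∧ adj A (proj₁ z) (proj₂ z)

      from : (Fin n → Bool) → Adj n → Fin n × Fin n → Bool
      from S A z = S (proj₁ z) ∧ adj A (proj₁ z) (proj₂ z)

      R R′ : Adj n → Quad n → Bool
      R A z = Loose A ∧ (atAnchor A (proj₁ z) ∧ from (outside A) A (proj₂ z))
      R′ A z = Moderate A ∧ (atAnchor A (proj₁ z) ∧ from (component A v) A (proj₂ z))

      -- The degree of `v`, written in the form in which the darts at the single vertex `v` are
      -- counted.
      dv : ℕ
      dv = sum (map (λ i → bit (i ≟ᵇ v) * lookup d i) (allFin n))

      atAnchor-count : ∀ {A} → IsGraph d A → count (atAnchor A) (pairs n) ≡ dv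
      atAnchor-count g = Degrees.count-dartsFrom g positive (_≟ᵇ v)

      1≤dv : 1 ≤ dv
      1≤dv = ≤-trans (size-injection {1} (λ _ → v) (_≟ᵇ v) (λ _ → ≡⇒≟ᵇ {i = v} refl) (λ { zero zero _ → refl }))
        (≤-trans (≤-reflexive (sym (*-identityʳ _))) (sum-const-on (_≟ᵇ v) 1 _ (allFin n) degree-positive))
        where
        degree-positive : ∀ i → T (i ≟ᵇ v) → 1 ≤ bit (i ≟ᵇ v) * lookup d i
        degree-positive i h with i ≟ᵇ v
        ... | true = ≤-trans (positive i) (m≤m+n _ 0)

      outside-two : ∀ {A} (g : IsGraph d A) u → T (outside A u) → lookup d u ≡ 2
      outside-two {A} g u h = Degrees.¬nontwo⇒Two g positive λ nt →
        not-T (proj₁ (T-split {not (core d A u)} h)) (core⁺ d A u nt (reach-refl A u))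

      -- The at least n/2 vertices outside start two darts each, and each of these `n` darts
      -- combines with every dart at `v`.
      out-degree : ∀ A → T (Loose A) → dv * n ≤ count (R A) (quads n)
      out-degree A h = begin
        dv * n ≤⟨ *-monoʳ-≤ dv (≤-trans (≤ᵇ⇒≤ n _ (proj₂ (T-split {not (hasBig A)} (proj₂ (T-split {isGraph d A} h))))) (≤-reflexive (*-comm 2 (size (outside A))))) ⟩
        dv * (size (outside A) * 2) ≤⟨ *-monoʳ-≤ dv (≤-trans (sum-const-on (outside A) 2 _ (allFin n) two-each)
            (≤-reflexive (sym (Degrees.count-dartsFrom g positive (outside A))))) ⟩
        dv * count (from (outside A) A) (pairs n) ≡⟨ cong (_* count (from (outside A) A) (pairs n)) (sym (atAnchor-count g)) ⟩
        count (atAnchor A) (pairs n) * count (from (outside A) A) (pairs n) ≡⟨ sym (count-× (atAnchor A) (from (outside A) A) (pairs n) (pairs n)) ⟩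
        count (λ z → atAnchor A (proj₁ z) ∧ from (outside A) A (proj₂ z)) (quads n) ≤⟨ count-mono _ (R A) (quads n) (λ z x → T-pair {Loose A} h x) ⟩
        count (R A) (quads n) ∎
        where
        open ≤-Reasoning
        g = isGraph⇒ d A (proj₁ (T-split {isGraph d A} h))
        two-each : ∀ i → T (outside A i) → 2 ≤ bit (outside A i) * lookup d i
        two-each i o = case-bit (outside A i) o
          where
          case-bit : ∀ b → T b → 2 ≤ bit b * lookup d i
          case-bit true _ = ≤-reflexive (trans (sym (outside-two g i o)) (sym (+-identityʳ _)))

      -- A reversed move consists of a dart at `v` and a dart in the component of `v`. Of the latter
      -- there are at most 2 (n/4) + M, and M is at most n/4 by `few`.
      in-degree : ∀ A → T (Moderate A) → count (R′ A) (quads n) * 4 ≤ 3 * (dv * n)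
      in-degree A h = begin
        count (R′ A) (quads n) * 4 ≤⟨ *-monoˡ-≤ 4 (count-mono (R′ A) _ (quads n) (λ z x → proj₂ (T-split {Moderate A} x))) ⟩
        count (λ z → atAnchor A (proj₁ z) ∧ from (component A v) A (proj₂ z)) (quads n) * 4
          ≡⟨ cong (_* 4) (count-× (atAnchor A) (from (component A v) A) (pairs n) (pairs n)) ⟩
        count (atAnchor A) (pairs n) * count (from (component A v) A) (pairs n) * 4
          ≡⟨ cong (λ k → k * count (from (component A v) A) (pairs n) * 4) (atAnchor-count g) ⟩
        dv * count (from (component A v) A) (pairs n) * 4 ≤⟨ *-monoˡ-≤ 4 (*-monoʳ-≤ dv (Degrees.dartsFrom-≤ g positive (component A v))) ⟩
        dv * (size (component A v) * 2 + M d) * 4 ≡⟨ rearrange₁ dv (size (component A v)) (M d) ⟩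
        dv * (2 * (4 * size (component A v)) + 4 * M d) ≤⟨ *-monoʳ-≤ dv (+-mono-≤ (*-monoʳ-≤ 2 (≤ᵇ⇒≤ (4 * size (component A v)) n (proj₂ (T-split {isGraph d A} h)))) few) ⟩
        dv * (2 * n + n) ≡⟨ rearrange₂ dv n ⟩
        3 * (dv * n) ∎
        where
        open ≤-Reasoning
        g = isGraph⇒ d A (proj₁ (T-split {isGraph d A} h))
        rearrange₁ : ∀ x s k → x * (s * 2 + k) * 4 ≡ x * (2 * (4 * s) + 4 * k)
        rearrange₁ = solve-∀
        rearrange₂ : ∀ x k → x * (2 * k + k) ≡ 3 * (x * k)
        rearrange₂ = solve-∀

      -- The switch absorbs the cycle through z into the component of v.
      absorb : ∀ A → IsGraph d A → ¬ T (hasBig A) → ∀ {w z y} → E A v w → T (outside A z) → E A z y →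
        T (R′ (switch v w z y A) ((v , z) , (w , y)))
      absorb A g ¬big {w} {z} {y} vw oz zy = conclude (switch-isGraph g merge-valid) (switch-switched g merge-valid)
        where
        open IsGraph g
        out = T-split {not (core d A z)} oz
        y⇝z : Reach A y z
        y⇝z = reach-edge A (flip _ _ zy)
        cyclic : ∀ u → Reach A y u → lookup d u ≡ 2
        cyclic u r = Degrees.¬nontwo⇒Two g positive λ nt →
          not-T (proj₁ out) (core⁺ d A u nt (reach-trans A (reach-sym A flip r) y⇝z))
        apart : ¬ Reach A y v
        apart r = not-T (proj₂ out) (reach-trans A (reach-sym A flip r) y⇝z)
        open Walks.Merge g vw zy cyclic apart
        conclude : ∀ {C} → IsGraph d C → Switched A C v w z y → T (R′ C ((v , z) , (w , y)))
        conclude {C} gC sw = T-pair {Moderate C} (T-pair (⇒isGraph d C gC) (≤⇒≤ᵇ moderate))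
          (T-pair {atAnchor C (v , z)} (T-pair (≡⇒≟ᵇ {i = v} refl) add₁) (T-pair v⇝w add₂))
          where
          open Switched sw
          flipC = IsGraph.flip gC
          v⇝w : Reach C v w
          v⇝w = reach-snoc C (merge-joins flipC sw) (flipC _ _ add₂)
          moderate : 4 * size (component C v) ≤ n
          moderate = *-cancelˡ-≤ 2 (begin
            2 * (4 * size (component C v)) ≤⟨ *-monoʳ-≤ 2 (*-monoʳ-≤ 4 (count-∨ (component C v) (component A v) (component A y) (allFin n)
                (λ u r → merge-component flipC sw r))) ⟩
            2 * (4 * (size (component A v) + size (component A y))) ≡⟨ rearrange (size (component A v)) (size (component A y)) ⟩
            8 * size (component A v) + 8 * size (component A y) ≤⟨ +-mono-≤ (<⇒≤ (small-components 8a≤D ¬big v)) (<⇒≤ (small-components 8a≤D ¬big y)) ⟩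
            n + n ≡⟨ cong (n +_) (sym (+-identityʳ n)) ⟩
            2 * n ∎)
            where
            open ≤-Reasoning
            rearrange : ∀ s t → 2 * (4 * (s + t)) ≡ 8 * s + 8 * t
            rearrange = solve-∀

      forth : ∀ A q → T (R A q) → T (R′ (switchAt q A) (transposed q))
      forth A ((p , w) , (z , y)) h with T-split {Loose A} h
      ... | l , e with T-split {isGraph d A} l | T-split {atAnchor A (p , w)} e
      ...   | gr , nb | e₁ , e₂ with T-split {p ≟ᵇ v} e₁ | T-split {outside A z} e₂
      ...     | p≡v , pw | oz , zy with ≟ᵇ⇒≡ p≡v
      ...       | refl = absorb A (isGraph⇒ d A gr) (not-T (proj₁ (T-split {not (hasBig A)} nb))) pw oz zy

    -- Out-degree and in-degree share the factor `dv * n`, which cancels, so the ratio 3/4 does not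
    -- depend on the degree of `v`.
    loose-bound : 4 * countAdj Loose ≤ 3 * countAdj (isGraph d)
    loose-bound = cancel dv n 1≤dv v (begin
      4 * countAdj Loose * (dv * n) ≡⟨ rearrange₁ (countAdj Loose) (dv * n) ⟩
      countAdj Loose * (dv * n) * 4 ≤⟨ *-monoˡ-≤ 4 (sum-const-on Loose (dv * n) (λ A → count (R A) (quads n)) (allAdj n) out-degree) ⟩
      sum (map (λ A → count (R A) (quads n)) (allAdj n)) * 4 ≤⟨ *-monoˡ-≤ 4 (double-count R R′ forth) ⟩
      sum (map (λ A → count (R′ A) (quads n)) (allAdj n)) * 4 ≡⟨ sym (sum-*ʳ (λ A → count (R′ A) (quads n)) 4 (allAdj n)) ⟩
      sum (map (λ A → count (R′ A) (quads n) * 4) (allAdj n)) ≤⟨ sum-bound-on Moderate (3 * (dv * n)) _ (allAdj n) in-degree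
          (λ A ¬m → cong (_* 4) (n≤0⇒n≡0 (count-≤-list (R′ A) {ys = []} (quads-unique n) (λ q x → ⊥-elim (¬m (proj₁ (T-split {Moderate A} x))))))) ⟩
      countAdj Moderate * (3 * (dv * n)) ≤⟨ *-monoˡ-≤ (3 * (dv * n)) (count-mono Moderate (isGraph d) (allAdj n) (λ A x → proj₁ (T-split {isGraph d A} x))) ⟩
      countAdj (isGraph d) * (3 * (dv * n)) ≡⟨ rearrange₂ (countAdj (isGraph d)) (dv * n) ⟩
      3 * countAdj (isGraph d) * (dv * n) ∎)
      where
      open ≤-Reasoning
      rearrange₁ : ∀ x k → 4 * x * k ≡ x * k * 4
      rearrange₁ = solve-∀
      rearrange₂ : ∀ x k → x * (3 * k) ≡ 3 * x * k
      rearrange₂ = solve-∀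
      cancel : ∀ k n → 1 ≤ k → Fin n → ∀ {x y} → x * (k * n) ≤ y * (k * n) → x ≤ y
      cancel (suc k) (suc n) _ _ {x} {y} = *-cancelʳ-≤ x y (suc k * suc n)

  -- Assembling the lower bound.

  module Joining (a D : ℕ) (8a≤D : 8 * a ≤ D) {n : ℕ} {d : Vec ℕ n} (positive : Positive d) (v : Fin n) (m : ℕ) (1≤m : 1 ≤ m)
    (small-near : 8 * (M d + (2 + (m + m + m)) * M d) < 2 * n) (few : 4 * M d ≤ n) (thin : 8 * (M d * m) < 3 * n) where

    open Big a D
    open Growing a D 8a≤D {d = d} positive m 1≤m small-near
    open Anchoring a D 8a≤D {d = d} positive v few

    loose-or-level : ∀ A → T (isGraph d A) → T (Loose A) ⊎ T (Level 0 A)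
    loose-or-level A gr with T? (hasBig A)
    ... | yes b = inj₂ (T-pair gr (T-inl b))
    ... | no ¬b with n ≤? 2 * size (outside A)
    ...   | yes le = inj₁ (T-pair gr (T-pair (T-not ¬b) (≤⇒≤ᵇ le)))
    ...   | no ¬le = inj₂ (T-pair gr (T-inr {hasBig A} (T-pair (≤⇒≤ᵇ large) hubs)))
      where
      open ≤-Reasoning
      cover : n ≤ size (outside A) + (size (component A v) + size (core d A))
      cover = begin
        n ≡⟨ sym (trans (count-true (allFin n)) (length-tabulate id)) ⟩
        size {n} (λ _ → true) ≤⟨ count-∨ (λ _ → true) (outside A) (λ u → component A v u ∨ core d A u) (allFin n) (λ u _ →
           T-dec (core d A u) (λ c → inj₂ (T-inr {component A v u} c)) (λ ¬c → T-dec (component A v u) (λ r → inj₂ (T-inl r))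
             (λ ¬r → inj₁ (T-pair (T-not ¬c) (T-not ¬r))))) ⟩
        size (outside A) + size (λ u → component A v u ∨ core d A u) ≤⟨ +-monoʳ-≤ (size (outside A))
          (count-∨ _ (component A v) (core d A) (allFin n) (λ u → T-cases {component A v u})) ⟩
        size (outside A) + (size (component A v) + size (core d A)) ∎
      -- Of `8 * n`, the vertices outside take at most `4 * n` and the component of `v` at most `n`.
      large : 3 * n ≤ 8 * size (core d A)
      large = +-cancelˡ-≤ (5 * n) _ _ (begin
        5 * n + 3 * n ≡⟨ rearrange₁ n ⟩
        8 * n ≤⟨ *-monoʳ-≤ 8 cover ⟩
        8 * (size (outside A) + (size (component A v) + size (core d A))) ≡⟨ rearrange₂ (size (outside A)) (size (component A v)) (size (core d A)) ⟩
        4 * (2 * size (outside A)) + 8 * size (component A v) + 8 * size (core d A)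
          ≤⟨ +-monoˡ-≤ (8 * size (core d A)) (+-mono-≤ (*-monoʳ-≤ 4 (<⇒≤ (≰⇒> ¬le))) (<⇒≤ (small-components 8a≤D ¬b v))) ⟩
        4 * n + n + 8 * size (core d A) ≡⟨ cong (_+ 8 * size (core d A)) (rearrange₃ n) ⟩
        5 * n + 8 * size (core d A) ∎)
        where
        rearrange₁ : ∀ n → 5 * n + 3 * n ≡ 8 * n
        rearrange₁ = solve-∀
        rearrange₂ : ∀ x y z → 8 * (x + (y + z)) ≡ 4 * (2 * x) + 8 * y + 8 * z
        rearrange₂ = solve-∀
        rearrange₃ : ∀ n → 4 * n + n ≡ 5 * n
        rearrange₃ = solve-∀
      -- Without a hub every component in the core has at most `m` vertices, so the core has at most
      -- `M d * m`, which `thin` makes less than 3 n/8.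
      hubs : T (anyFin (hub 0 A))
      hubs = T-dec (anyFin (hub 0 A)) id λ none → ⊥-elim (<-irrefl refl (<-≤-trans thin (≤-trans large (*-monoʳ-≤ 8
        (≤-trans (core-≤ m (λ z nt → <⇒≤ (≰⇒> λ le → none (anyFin⁺ (hub 0 A) z
            (T-pair nt (≤⇒≤ᵇ {1 * m} (≤-trans (≤-reflexive (+-identityʳ m)) le)))))))
          (*-monoˡ-≤ m (Degrees.count-nontwo (isGraph⇒ d A gr) positive)))))))

    -- As at most 3/4 of all graphs are loose, at least 1/4 are on level 0; hence the factor 4.
    join-bound : ∀ c T′ → (n * 2 + M d) * (n * 2 + M d) ≤ c * (m * m) → n ≤ T′ * m →
      countAdj (isGraph d) ≤ 4 * ((suc c * suc c) ^ T′ * countAdj (λ A → isGraph d A ∧ hasBig A))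
    join-bound c T′ D²≤ n≤ = ≤-trans (+-cancelˡ-≤ (3 * countAdj (isGraph d)) _ _ (begin
      3 * countAdj (isGraph d) + countAdj (isGraph d) ≡⟨ rearrange (countAdj (isGraph d)) ⟩
      4 * countAdj (isGraph d) ≤⟨ *-monoʳ-≤ 4 (count-∨ (isGraph d) Loose (Level 0) (allAdj n) loose-or-level) ⟩
      4 * (countAdj Loose + countAdj (Level 0)) ≡⟨ *-distribˡ-+ 4 (countAdj Loose) _ ⟩
      4 * countAdj Loose + 4 * countAdj (Level 0) ≤⟨ +-monoˡ-≤ (4 * countAdj (Level 0)) loose-bound ⟩
      3 * countAdj (isGraph d) + 4 * countAdj (Level 0) ∎)) (*-monoʳ-≤ 4 (grow-bound c T′ D²≤ n≤))
      where
      open ≤-Reasoning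
      rearrange : ∀ x → 3 * x + x ≡ 4 * x
      rearrange = solve-∀

  -- Choice of the constants.

  module Constants (b a D : ℕ) (1≤a : 1 ≤ a) (8a≤D : 8 * a ≤ D) where

    open Big a D

    -- With `m` the integer part of n/κ and at least 1, `n ≤ 2 * κ * m`, which is the origin of
    -- `T′`; then 2 n + M ≤ 3 n ≤ 6 κ m gives `c` on squaring. `Q` is a sum so that it serves both
    -- bounds, and `suc b` keeps `κ` positive when `b` is 0.
    κ T′ c Q : ℕ
    κ = 8 * (suc b * D)
    T′ = 2 * κ
    c = 36 * (κ * κ)
    Q = 4 * (suc c * suc c) ^ T′ + suc c ^ T′

    module _ {n : ℕ} (κ<n : κ < n) {d : Vec ℕ n} (positive : Positive d) (M≤b : M d ≤ b) where

      private
        8≤D : 8 ≤ D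
        8≤D = ≤-trans (*-monoʳ-≤ 8 1≤a) 8a≤D

        instance
          κ≢0 : NonZero κ
          κ≢0 = >-nonZero (*-mono-≤ {1} {8} (s≤s z≤n) (*-mono-≤ {1} {suc b} (s≤s z≤n) (≤-trans (s≤s z≤n) 8≤D)))

        m w : ℕ
        m = n div κ
        w = suc b * D * m

        1≤m : 1 ≤ m
        1≤m = m≥n⇒m/n>0 (<⇒≤ κ<n)

        8w≤n : 8 * w ≤ n
        8w≤n = ≤-trans (≤-reflexive (rearrange (suc b * D) m)) (m/n*n≤m n κ)
          where
          rearrange : ∀ x m → 8 * (x * m) ≡ m * (8 * x)
          rearrange = solve-∀

        n≤T : n ≤ T′ * m
        n≤T = begin
          n ≡⟨ m≡m%n+[m/n]*n n κ ⟩
          n mod κ + m * κ ≤⟨ +-monoˡ-≤ (m * κ) (≤-trans (<⇒≤ (m%n<n n κ)) (≤-trans (≤-reflexive (sym (*-identityˡ κ))) (*-monoˡ-≤ κ 1≤m))) ⟩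
          m * κ + m * κ ≡⟨ rearrange m κ ⟩
          2 * κ * m ∎
          where
          open ≤-Reasoning
          rearrange : ∀ m k → m * k + m * k ≡ 2 * k * m
          rearrange = solve-∀

        8bm≤w : 8 * (suc b * m) ≤ w
        8bm≤w = ≤-trans (≤-reflexive (rearrange (suc b) m)) (*-monoˡ-≤ m (*-monoʳ-≤ (suc b) 8≤D))
          where
          rearrange : ∀ x m → 8 * (x * m) ≡ x * 8 * m
          rearrange = solve-∀

        1≤w : 1 ≤ w
        1≤w = ≤-trans (*-mono-≤ {1} {8} (s≤s z≤n) (*-mono-≤ {1} {suc b} (s≤s z≤n) 1≤m)) 8bm≤w

        -- The smallness conditions are all brought to this form; the room comes from `8 * w ≤ n`
        -- with `w` positive.
        sixfold : ∀ {x} → x ≤ 6 * w → x < n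
        sixfold h = <-≤-trans (≤-<-trans h (*-monoˡ-< w {{>-nonZero 1≤w}} {6} {8} (s≤s (s≤s (s≤s (s≤s (s≤s (s≤s (s≤s z≤n))))))))) 8w≤n

        n≤ : ∀ k → 1 ≤ k → n ≤ k * n
        n≤ k h = ≤-trans (≤-reflexive (sym (*-identityˡ n))) (*-monoˡ-≤ n h)

        near≤ : M d + (2 + (m + m + m)) * M d ≤ 6 * (suc b * m)
        near≤ = begin
          M d + (2 + (m + m + m)) * M d ≡⟨ rearrange₁ (M d) m ⟩
          M d * 3 + M d * m * 3 ≤⟨ +-mono-≤ (*-monoˡ-≤ 3 (≤-trans (≤-reflexive (sym (*-identityʳ (M d)))) (*-mono-≤ M≤b′ 1≤m))) (*-monoˡ-≤ 3 (*-monoˡ-≤ m M≤b′)) ⟩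
          suc b * m * 3 + suc b * m * 3 ≡⟨ rearrange₂ (suc b * m) ⟩
          6 * (suc b * m) ∎
          where
          open ≤-Reasoning
          M≤b′ : M d ≤ suc b
          M≤b′ = m≤n⇒m≤1+n M≤b
          rearrange₁ : ∀ x m → x + (2 + (m + m + m)) * x ≡ x * 3 + x * m * 3
          rearrange₁ = solve-∀
          rearrange₂ : ∀ x → x * 3 + x * 3 ≡ 6 * x
          rearrange₂ = solve-∀

        split-near : (M d + (2 + (m + m + m)) * M d) * D < a * n
        split-near = <-≤-trans (sixfold (≤-trans (*-monoˡ-≤ D near≤) (≤-reflexive (rearrange (suc b) m D)))) (n≤ a 1≤a)
          where
          rearrange : ∀ x m y → 6 * (x * m) * y ≡ 6 * (x * y * m)
          rearrange = solve-∀

        split-segment : (2 + (m + m + m)) * D < a * n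
        split-segment = <-≤-trans (sixfold (begin
          (2 + (m + m + m)) * D ≤⟨ *-monoˡ-≤ D (≤-trans (+-monoˡ-≤ (m + m + m) (*-monoʳ-≤ 2 1≤m)) (≤-trans (≤-reflexive (rearrange₁ m)) (*-monoˡ-≤ m (n≤1+n 5)))) ⟩
          6 * m * D ≤⟨ *-monoˡ-≤ D (*-monoʳ-≤ 6 (m≤m+n m (b * m))) ⟩
          6 * (suc b * m) * D ≡⟨ rearrange₂ (suc b) m D ⟩
          6 * w ∎)) (n≤ a 1≤a)
          where
          open ≤-Reasoning
          rearrange₁ : ∀ m → 2 * m + (m + m + m) ≡ 5 * m
          rearrange₁ = solve-∀
          rearrange₂ : ∀ x m y → 6 * (x * m) * y ≡ 6 * (x * y * m)
          rearrange₂ = solve-∀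

        join-near : 8 * (M d + (2 + (m + m + m)) * M d) < 2 * n
        join-near = <-≤-trans (sixfold (≤-trans (*-monoʳ-≤ 8 near≤) (≤-trans (≤-reflexive (rearrange (suc b * m))) (*-monoʳ-≤ 6 8bm≤w)))) (n≤ 2 (s≤s z≤n))
          where
          rearrange : ∀ x → 8 * (6 * x) ≡ 6 * (8 * x)
          rearrange = solve-∀

        Mm≤w : 8 * (M d * m) ≤ w
        Mm≤w = ≤-trans (*-monoʳ-≤ 8 (*-monoˡ-≤ m (m≤n⇒m≤1+n M≤b))) 8bm≤w

        w≤6w : w ≤ 6 * w
        w≤6w = m≤n*m w 6

        8M≤w : 8 * M d ≤ w
        8M≤w = ≤-trans (*-monoʳ-≤ 8 (≤-trans (≤-reflexive (sym (*-identityʳ (M d)))) (*-monoʳ-≤ (M d) 1≤m))) Mm≤w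

        darts² : (n * 2 + M d) * (n * 2 + M d) ≤ c * (m * m)
        darts² = ≤-trans (*-mono-≤ linear linear) (≤-reflexive (rearrange κ m))
          where
          rearrange : ∀ k m → (3 * (2 * k * m)) * (3 * (2 * k * m)) ≡ 36 * (k * k) * (m * m)
          rearrange = solve-∀
          linear : n * 2 + M d ≤ 3 * (T′ * m)
          linear = begin
            n * 2 + M d ≤⟨ +-monoʳ-≤ (n * 2) (≤-trans (m≤n*m (M d) 8) (<⇒≤ (sixfold (≤-trans 8M≤w w≤6w)))) ⟩
            n * 2 + n ≡⟨ add n ⟩
            3 * n ≤⟨ *-monoʳ-≤ 3 n≤T ⟩
            3 * (T′ * m) ∎
            where
            open ≤-Reasoning
            add : ∀ n → n * 2 + n ≡ 3 * n
            add = solve-∀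

      few-without-big : countAdj (isGraph d) ≤ Q * countAdj (λ A → isGraph d A ∧ not (hasBig A))
      few-without-big = ≤-trans (Splitting.split-bound {d = d} positive m 1≤m split-near split-segment c T′ darts² n≤T)
        (*-monoˡ-≤ (countAdj (λ A → isGraph d A ∧ not (hasBig A))) (m≤n+m (suc c ^ T′) (4 * (suc c * suc c) ^ T′)))

      few-with-big : countAdj (isGraph d) ≤ Q * countAdj (λ A → isGraph d A ∧ hasBig A)
      -- The fixed vertex is the one of index `κ`, which exists because `κ < n`.
      few-with-big = ≤-trans (Joining.join-bound a D 8a≤D {d = d} positive (fromℕ< κ<n) m 1≤m join-near
          (<⇒≤ (sixfold (≤-trans (*-monoˡ-≤ (M d) (m≤m+n 4 4)) (≤-trans 8M≤w w≤6w))))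
          (<-≤-trans (sixfold (≤-trans Mm≤w w≤6w)) (n≤ 3 (s≤s z≤n)))
          c T′ darts² n≤T)
        (≤-trans (≤-reflexive (sym (*-assoc 4 ((suc c * suc c) ^ T′) _))) (*-monoˡ-≤ (countAdj (λ A → isGraph d A ∧ hasBig A)) (m≤m+n (4 * (suc c * suc c) ^ T′) (suc c ^ T′))))

  -- Translation into rational inequalities.

  ℕ→ℚ-mkℚ : ∀ n → ℕ→ℚ n ≡ ℚ.mkℚ (ℤ.+ n) 0 (coprime-sym (1-coprimeTo n))
  ℕ→ℚ-mkℚ n = ℚP.normalize-coprime (coprime-sym (1-coprimeTo n))

  toℚᵘ-ℕ→ℚ : ∀ n → ℚ.toℚᵘ (ℕ→ℚ n) ≡ ℚᵘ.mkℚᵘ (ℤ.+ n) 0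
  toℚᵘ-ℕ→ℚ n = cong ℚ.toℚᵘ (ℕ→ℚ-mkℚ n)

  module _ (a D-1 : ℕ) .(co : Coprime a (suc D-1)) (n k : ℕ) where

    private
      γ : ℚ.ℚ
      γ = ℚ.mkℚ (ℤ.+ a) D-1 co

      lhs : ℚ.toℚᵘ (γ ℚ.* ℕ→ℚ n) ℚᵘ.≃ ℚᵘ.mkℚᵘ (ℤ.+ a) D-1 ℚᵘ.* ℚᵘ.mkℚᵘ (ℤ.+ n) 0
      lhs = subst (λ z → ℚ.toℚᵘ (γ ℚ.* ℕ→ℚ n) ℚᵘ.≃ ℚᵘ.mkℚᵘ (ℤ.+ a) D-1 ℚᵘ.* z) (toℚᵘ-ℕ→ℚ n) (ℚP.toℚᵘ-homo-* γ (ℕ→ℚ n))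

      numerators : (ℤ.+ a ℤ.* ℤ.+ n) ℤ.* ℤ.+ 1 ≡ ℤ.+ (a * n)
      numerators = trans (ℤP.*-identityʳ _) (sym (ℤP.pos-* a n))

      denominators : ℤ.+ k ℤ.* ℤ.+ (suc D-1 * 1) ≡ ℤ.+ (k * suc D-1)
      denominators = trans (cong (λ z → ℤ.+ k ℤ.* ℤ.+ z) (*-identityʳ (suc D-1))) (sym (ℤP.pos-* k (suc D-1)))

    fraction-≤⁺ : a * n ≤ k * suc D-1 → γ ℚ.* ℕ→ℚ n ℚ.≤ ℕ→ℚ k
    fraction-≤⁺ h = ℚP.toℚᵘ-cancel-≤ (subst (ℚ.toℚᵘ (γ ℚ.* ℕ→ℚ n) ℚᵘ.≤_) (sym (toℚᵘ-ℕ→ℚ k))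
      (ℚᵘP.≤-respˡ-≃ (ℚᵘP.≃-sym lhs) (ℚᵘ.*≤* (subst₂ ℤ._≤_ (sym numerators) (sym denominators) (ℤ.+≤+ h)))))

    fraction-≤⁻ : γ ℚ.* ℕ→ℚ n ℚ.≤ ℕ→ℚ k → a * n ≤ k * suc D-1
    fraction-≤⁻ h with ℚᵘP.≤-respˡ-≃ lhs (subst (ℚ.toℚᵘ (γ ℚ.* ℕ→ℚ n) ℚᵘ.≤_) (toℚᵘ-ℕ→ℚ k) (ℚP.toℚᵘ-mono-≤ h))
    ... | ℚᵘ.*≤* i = ℤP.drop‿+≤+ (subst₂ ℤ._≤_ numerators denominators i)

  ℕ→ℚ-mono : ∀ {x y} → x ≤ y → ℕ→ℚ x ℚ.≤ ℕ→ℚ y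
  ℕ→ℚ-mono {x} {y} h = subst₂ ℚ._≤_ (sym (ℕ→ℚ-mkℚ x)) (sym (ℕ→ℚ-mkℚ y))
    (ℚ.*≤* (subst₂ ℤ._≤_ (sym (ℤP.*-identityʳ _)) (sym (ℤP.*-identityʳ _)) (ℤ.+≤+ h)))

  ℕ→ℚ-+ : ∀ x y → ℕ→ℚ (x + y) ≡ ℕ→ℚ x ℚ.+ ℕ→ℚ y
  ℕ→ℚ-+ x y = ℚP.toℚᵘ-injective (ℚᵘP.≃-trans (ℚᵘP.≃-reflexive (toℚᵘ-ℕ→ℚ (x + y)))
    (ℚᵘP.≃-trans (ℚᵘ.*≡* (cong (ℤ._* ℤ.+ 1) (sym (cong₂ ℤ._+_ (ℤP.*-identityʳ (ℤ.+ x)) (ℤP.*-identityʳ (ℤ.+ y))))))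
      (ℚᵘP.≃-sym (subst₂ (λ u v → ℚ.toℚᵘ (ℕ→ℚ x ℚ.+ ℕ→ℚ y) ℚᵘ.≃ u ℚᵘ.+ v) (toℚᵘ-ℕ→ℚ x) (toℚᵘ-ℕ→ℚ y) (ℚP.toℚᵘ-homo-+ (ℕ→ℚ x) (ℕ→ℚ y))))))

  -- Turns a lower bound for the graphs without a large component into the upper bound for those
  -- with one.
  complement-≤ : ∀ δ t x y → x ℚ.+ y ℚ.≤ t → δ ℚ.* t ℚ.≤ y → x ℚ.≤ (ℚ.1ℚ ℚ.- δ) ℚ.* t
  complement-≤ δ t x y x+y≤t δt≤y = begin
    x ≡⟨ sym (ℚP.+-identityʳ x) ⟩
    x ℚ.+ ℚ.0ℚ ≡⟨ cong (x ℚ.+_) (sym (ℚP.+-inverseʳ (δ ℚ.* t))) ⟩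
    x ℚ.+ (δ ℚ.* t ℚ.- δ ℚ.* t) ≡⟨ sym (ℚP.+-assoc x _ _) ⟩
    x ℚ.+ δ ℚ.* t ℚ.- δ ℚ.* t ≤⟨ ℚP.+-monoˡ-≤ (ℚ.- (δ ℚ.* t)) (ℚP.≤-trans (ℚP.+-monoʳ-≤ x δt≤y) x+y≤t) ⟩
    t ℚ.- δ ℚ.* t ≡⟨ cong₂ ℚ._+_ (sym (ℚP.*-identityˡ t)) (ℚP.neg-distribˡ-* δ t) ⟩
    ℚ.1ℚ ℚ.* t ℚ.+ (ℚ.- δ) ℚ.* t ≡⟨ sym (ℚP.*-distribʳ-+ t ℚ.1ℚ (ℚ.- δ)) ⟩
    (ℚ.1ℚ ℚ.- δ) ℚ.* t ∎
    where open ℚP.≤-Reasoning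

  -- The probability bounds.

  module Probability (b a D-1 : ℕ) .(co : Coprime (suc a) (suc D-1)) (8a<D : 8 * suc a < suc D-1) where

    open Big (suc a) (suc D-1)
    open Constants b (suc a) (suc D-1) (s≤s z≤n) (<⇒≤ 8a<D) using (κ; Q; few-with-big; few-without-big)

    private
      γ : ℚ.ℚ
      γ = ℚ.mkℚ (ℤ.+ suc a) D-1 co

    hasBig⇒ : ∀ {n} (A : Adj n) → T (hasBig A) → T (hasComponentOfOrder≥ γ A)
    hasBig⇒ {n} A h with anyFin⁻ (bigAt A) h
    ... | v , bv = anyFin⁺ (λ v → (γ ℚ.* ℕ→ℚ n) ℚ.≤ᵇ ℕ→ℚ (componentOrder A v)) v
      (ℚP.≤⇒≤ᵇ (fraction-≤⁺ (suc a) D-1 co n (componentOrder A v)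
        (subst (λ s → suc a * n ≤ s * suc D-1) (sym (countFin≡count (component A v))) (≤ᵇ⇒≤ (suc a * n) _ bv))))

    ⇒hasBig : ∀ {n} (A : Adj n) → T (hasComponentOfOrder≥ γ A) → T (hasBig A)
    ⇒hasBig {n} A h with anyFin⁻ (λ v → (γ ℚ.* ℕ→ℚ n) ℚ.≤ᵇ ℕ→ℚ (componentOrder A v)) h
    ... | v , bv = anyFin⁺ (bigAt A) v (≤⇒≤ᵇ {suc a * n} (subst (λ s → suc a * n ≤ s * suc D-1) (countFin≡count (component A v))
      (fraction-≤⁻ (suc a) D-1 co n (componentOrder A v) (ℚP.≤ᵇ⇒≤ bv))))

    goodCount≡ : ∀ {n} (d : Vec ℕ n) → goodCount n d γ ≡ countAdj (λ A → isGraph d A ∧ hasBig A)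
    goodCount≡ {n} d = trans (count-nest (isGraph d) (hasComponentOfOrder≥ γ) (allAdj n)) (≤-antisym
      (count-mono _ _ (allAdj n) (λ A h → let (g , x) = T-split {isGraph d A} h in T-pair g (⇒hasBig A x)))
      (count-mono _ _ (allAdj n) (λ A h → let (g , x) = T-split {isGraph d A} h in T-pair g (hasBig⇒ A x))))

    -- This is 1/(Q + 2): the constructor takes the denominator minus 1, and the summand 2 keeps the
    -- value below 1 whatever `Q` is.
    δ : ℚ.ℚ
    δ = ℚ.mkℚ (ℤ.+ 1) (suc Q) (1-coprimeTo (suc (suc Q)))

    0<δ : ℚ.0ℚ ℚ.< δ
    0<δ = ℚ.*<* (ℤ.+<+ (s≤s z≤n))

    δ<1 : δ ℚ.< ℚ.1ℚ
    δ<1 = ℚ.*<* (ℤ.+<+ (s≤s (s≤s z≤n)))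

    δ-≤ : ∀ t x → t ≤ Q * x → δ ℚ.* ℕ→ℚ t ℚ.≤ ℕ→ℚ x
    δ-≤ t x h = fraction-≤⁺ 1 (suc Q) (1-coprimeTo (suc (suc Q))) t x (begin
      1 * t ≡⟨ *-identityˡ t ⟩
      t ≤⟨ h ⟩
      Q * x ≤⟨ *-monoˡ-≤ x (m≤n+m Q 2) ⟩
      suc (suc Q) * x ≡⟨ *-comm (suc (suc Q)) x ⟩
      x * suc (suc Q) ∎)
      where open ≤-Reasoning

    bounds : ∀ n → κ < n → (d : Vec ℕ n) → Positive d → M d ≤ b →
      (δ ℚ.* ℕ→ℚ (totalCount n d) ℚ.≤ ℕ→ℚ (goodCount n d γ))
      × (ℕ→ℚ (goodCount n d γ) ℚ.≤ (ℚ.1ℚ ℚ.- δ) ℚ.* ℕ→ℚ (totalCount n d))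
    bounds n κ<n d positive M≤b = subst (λ x → (δ ℚ.* ℕ→ℚ t ℚ.≤ ℕ→ℚ x) × (ℕ→ℚ x ℚ.≤ (ℚ.1ℚ ℚ.- δ) ℚ.* ℕ→ℚ t)) (sym (goodCount≡ d))
      ( δ-≤ t good (few-with-big κ<n {d} positive M≤b)
      , complement-≤ δ (ℕ→ℚ t) (ℕ→ℚ good) (ℕ→ℚ bad)
          (subst (ℚ._≤ ℕ→ℚ t) (ℕ→ℚ-+ good bad) (ℕ→ℚ-mono split)) (δ-≤ t bad (few-without-big κ<n {d} positive M≤b)) )
      where
      t good bad : ℕ
      t = totalCount n d
      good = countAdj (λ A → isGraph d A ∧ hasBig A)
      bad = countAdj (λ A → isGraph d A ∧ not (hasBig A))
      split : good + bad ≤ t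
      split = count-disjoint _ _ (isGraph d) (allAdj n) (λ A h → proj₁ (T-split {isGraph d A} h)) (λ A h → proj₁ (T-split {isGraph d A} h))
        (λ A h h′ → not-T (proj₂ (T-split {isGraph d A} h′)) (proj₂ (T-split {isGraph d A} h)))

  component-probability : (b : ℕ) (γ : ℚ.ℚ) → ℚ.0ℚ ℚ.< γ → γ ℚ.< ℤ.+ 1 ℚ./ 8 →
    Σ ℕ λ N → Σ ℚ.ℚ λ δ → (0 < N) × (ℚ.0ℚ ℚ.< δ) × (δ ℚ.< ℚ.1ℚ) ×
      ((n : ℕ) → N < n → (d : Vec ℕ n) → Positive d → Realizable d → M d ≤ b →
        (δ ℚ.* ℕ→ℚ (totalCount n d) ℚ.≤ ℕ→ℚ (goodCount n d γ))
        × (ℕ→ℚ (goodCount n d γ) ℚ.≤ (ℚ.1ℚ ℚ.- δ) ℚ.* ℕ→ℚ (totalCount n d)))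
  component-probability b (ℚ.mkℚ (ℤ.+ zero) _ _) (ℚ.*<* (ℤ.+<+ ())) _
  component-probability b (ℚ.mkℚ ℤ.-[1+ _ ] _ _) (ℚ.*<* ()) _
  component-probability b (ℚ.mkℚ (ℤ.+ suc a) D-1 co) _ (ℚ.*<* γ<) =
    -- The successor makes the threshold visibly positive.
    suc κ , δ , s≤s z≤n , 0<δ , δ<1 , λ n N<n d positive _ M≤b → bounds n (<-trans (n<1+n κ) N<n) d positive M≤b
    where
    8a<D : 8 * suc a < suc D-1
    8a<D = subst₂ _<_ (*-comm (suc a) 8) (*-identityˡ (suc D-1))
      (ℤP.drop‿+<+ (subst₂ ℤ._<_ (sym (ℤP.pos-* (suc a) 8)) (sym (ℤP.pos-* 1 (suc D-1))) γ<))
    open Probability b a D-1 co 8a<D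
    open Constants b (suc a) (suc D-1) (s≤s z≤n) (<⇒≤ 8a<D) using (κ)

open import Data.Nat using (ℕ; _>_; _≤_)
open import Data.Vec using (Vec)
open import Data.Product using (Σ; _×_)
open import Data.Rational using (ℚ; 0ℚ; 1ℚ; _/_; _<_; _*_; _-_)
open import Data.Integer using (+_)
import Data.Rational

theorem6 : (b : ℕ) (γ : ℚ) → 0ℚ < γ → γ < + 1 / 8 →
    Σ ℕ λ N → Σ ℚ λ δ → (N > 0) × (0ℚ < δ) × (δ < 1ℚ) ×
    ((n : ℕ) → n > N → (d : Vec ℕ n) → Positive d → Realizable d → M d ≤ b →
    Data.Rational._≤_ (δ * ℕ→ℚ (totalCount n d)) (ℕ→ℚ (goodCount n d γ))
    × Data.Rational._≤_ (ℕ→ℚ (goodCount n d γ)) ((1ℚ - δ) * ℕ→ℚ (totalCount n d)))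
theorem6 = Switching.component-probability
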